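{- For all $N,r\geq0$ and $f\in\mathrm{QSym}_N$, $$\Psi_{N+r,q}(h_rf;t)=Q_r\,\Psi_{N,q}(f;t).$$ The operators $Q_r$ commute pairwise.
   Context: $q$ is an indeterminate and identities are in $\mathbb Q(q)[[t]]$. $\mathrm{QSym}_N$ is the degree-$N$ homogeneous component of the ring of quasisymmetric functions over $\mathbb Q$ in commuting variables $z_1,z_2,\ldots$, and $h_r=\sum_{1\leq i_1\leq\cdots\leq i_r}z_{i_1}\cdots z_{i_r}$ ($h_0=1$) is the complete homogeneous symmetric function. For $f\in\mathrm{QSym}_N$, $$\Psi_{N,q}(f;t)=\sum_{k\geq0}f(q^k,q^{k-1},\ldots,q,1,0,0,\ldots)\,t^k,$$ i.e. in the $k$-th term $z_{i+1}=q^{k-i}$ for $0\leq i\leq k$ and $z_i=0$ for $i>k+1$. $\Theta_q$ is the $q$-shift $\Theta_qF(t)=F(qt)$ on $\mathbb Q(q)[[t]]$, and $$Q_r=\prod_{i=1}^{r}\frac{1-q^i\Theta_q}{1-q^i},\qquad Q_0=\mathrm{id}.$$ -}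

module Defs where

open import Level using (0ℓ)
open import Function.Base using (_∘_; id)
open import Data.Bool.Base using (if_then_else_)
open import Data.Product.Base using (∃; _×_; _,_)
open import Data.Nat as ℕ using (ℕ; zero; suc; _∸_; _<?_)
import Data.Nat.Properties as ℕ
open import Data.Nat.ListAction using (sum)
open import Data.Fin as Fin using (Fin; zero; suc)
open import Data.Rational as ℚ using (ℚ; 0ℚ; 1ℚ)
import Data.Rational.Properties as ℚ
open import Data.List.Base
  using (List; []; _∷_; _++_; [_]; map; foldr; concatMap; filter; length; upTo; downFrom; tabulate; zipWith)
open import Data.List.Properties using (≡-dec; filter-idem; tabulate-cong)
open import Data.List.Relation.Unary.All as All using (All; []; _∷_)
import Data.List.Relation.Unary.All.Properties as All
open import Relation.Nullary using (does; yes; no; contradiction)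
open import Relation.Nullary.Decidable using (dec-false)
open import Relation.Binary.PropositionalEquality
  using (_≡_; _≢_; refl; sym; trans; cong; cong₂; module ≡-Reasoning)
open import Algebra.Bundles.Raw using (RawRing)
import Algebra.Definitions.RawSemiring as RawSemiringDefs

-- ℚ[q] as coefficient lists, constant term first; trailing zeros are allowed
-- and disregarded by _≈ₚ_.

Poly : Set
Poly = List ℚ

coeffₚ : Poly → ℕ → ℚ
coeffₚ []      _       = 0ℚ
coeffₚ (a ∷ p) zero    = a
coeffₚ (a ∷ p) (suc n) = coeffₚ p n

infix  4 _≈ₚ_
infixl 6 _+ₚ_
infixl 7 _*ₚ_

_≈ₚ_ : Poly → Poly → Set
p ≈ₚ r = ∀ n → coeffₚ p n ≡ coeffₚ r n

_+ₚ_ : Poly → Poly → Poly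
[]      +ₚ r       = r
(a ∷ p) +ₚ []      = a ∷ p
(a ∷ p) +ₚ (b ∷ r) = (a ℚ.+ b) ∷ (p +ₚ r)

-ₚ_ : Poly → Poly
-ₚ_ = map (ℚ.-_)

_*ₚ_ : Poly → Poly → Poly
[]      *ₚ r = []
(a ∷ p) *ₚ r = map (a ℚ.*_) r +ₚ (0ℚ ∷ p *ₚ r)

NonZeroₚ : Poly → Set
NonZeroₚ p = ∃ λ n → coeffₚ p n ≢ 0ℚ

coeffₚ-+ : ∀ p r n → coeffₚ (p +ₚ r) n ≡ coeffₚ p n ℚ.+ coeffₚ r n
coeffₚ-+ []      r       n       = sym (ℚ.+-identityˡ _)
coeffₚ-+ (a ∷ p) []      n       = sym (ℚ.+-identityʳ _)
coeffₚ-+ (a ∷ p) (b ∷ r) zero    = refl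
coeffₚ-+ (a ∷ p) (b ∷ r) (suc n) = coeffₚ-+ p r n

coeffₚ-scale : ∀ a p n → coeffₚ (map (a ℚ.*_) p) n ≡ a ℚ.* coeffₚ p n
coeffₚ-scale a []      n       = sym (ℚ.*-zeroʳ a)
coeffₚ-scale a (b ∷ p) zero    = refl
coeffₚ-scale a (b ∷ p) (suc n) = coeffₚ-scale a p n

coeffₚ-∷-* : ∀ a p r n →
  coeffₚ ((a ∷ p) *ₚ r) n ≡ a ℚ.* coeffₚ r n ℚ.+ coeffₚ (0ℚ ∷ p *ₚ r) n
coeffₚ-∷-* a p r n =
  trans (coeffₚ-+ (map (a ℚ.*_) r) _ n) (cong (ℚ._+ _) (coeffₚ-scale a r n))

coeffₚ-*-zero : ∀ p r → coeffₚ (p *ₚ r) 0 ≡ coeffₚ p 0 ℚ.* coeffₚ r 0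
coeffₚ-*-zero []      r = sym (ℚ.*-zeroˡ (coeffₚ r 0))
coeffₚ-*-zero (a ∷ p) r = trans (coeffₚ-∷-* a p r 0) (ℚ.+-identityʳ _)

coeffₚ-*-shift : ∀ p r n → coeffₚ (p *ₚ (0ℚ ∷ r)) (suc n) ≡ coeffₚ (p *ₚ r) n
coeffₚ-*-shift []      r n = refl
coeffₚ-*-shift (a ∷ p) r n = begin
  coeffₚ ((a ∷ p) *ₚ (0ℚ ∷ r)) (suc n)                ≡⟨ coeffₚ-∷-* a p (0ℚ ∷ r) (suc n) ⟩
  a ℚ.* coeffₚ r n ℚ.+ coeffₚ (p *ₚ (0ℚ ∷ r)) n       ≡⟨ cong (a ℚ.* coeffₚ r n ℚ.+_) (lower n) ⟩
  a ℚ.* coeffₚ r n ℚ.+ coeffₚ (0ℚ ∷ p *ₚ r) n         ≡⟨ coeffₚ-∷-* a p r n ⟨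
  coeffₚ ((a ∷ p) *ₚ r) n                             ∎
  where
  open ≡-Reasoning
  lower : ∀ m → coeffₚ (p *ₚ (0ℚ ∷ r)) m ≡ coeffₚ (0ℚ ∷ p *ₚ r) m
  lower zero    = trans (coeffₚ-*-zero p (0ℚ ∷ r)) (ℚ.*-zeroʳ (coeffₚ p 0))
  lower (suc m) = coeffₚ-*-shift p r m

*-nonZero : ∀ {a b} → a ≢ 0ℚ → b ≢ 0ℚ → a ℚ.* b ≢ 0ℚ
*-nonZero {a} {b} a≢0 b≢0 ab≡0 = b≢0 (begin
  b                       ≡⟨ ℚ.*-identityˡ b ⟨
  1ℚ ℚ.* b                ≡⟨ cong (ℚ._* b) (ℚ.*-inverseˡ a) ⟨
  (ℚ.1/ a) ℚ.* a ℚ.* b    ≡⟨ ℚ.*-assoc (ℚ.1/ a) a b ⟩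
  (ℚ.1/ a) ℚ.* (a ℚ.* b)  ≡⟨ cong ((ℚ.1/ a) ℚ.*_) ab≡0 ⟩
  (ℚ.1/ a) ℚ.* 0ℚ         ≡⟨ ℚ.*-zeroʳ (ℚ.1/ a) ⟩
  0ℚ                      ∎)
  where
  open ≡-Reasoning
  instance
    a-nonZero : ℚ.NonZero a
    a-nonZero = ℚ.≢-nonZero a≢0

*ₚ-nonZero : ∀ p r → NonZeroₚ p → NonZeroₚ r → NonZeroₚ (p *ₚ r)
*ₚ-nonZero []      r (_ , p≢0) _ = contradiction refl p≢0
*ₚ-nonZero (a ∷ p) r p≢0 r≢0 with a ℚ.≟ 0ℚ
... | yes refl = shifted p≢0
  where
  shifted : NonZeroₚ (0ℚ ∷ p) → NonZeroₚ ((0ℚ ∷ p) *ₚ r)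
  shifted (zero  , ≢0) = contradiction refl ≢0
  shifted (suc m , ≢0) with *ₚ-nonZero p r (m , ≢0) r≢0
  ... | k , pr≢0 = suc k , λ eq → pr≢0 (begin
    coeffₚ (p *ₚ r) k                                    ≡⟨ ℚ.+-identityˡ _ ⟨
    0ℚ ℚ.+ coeffₚ (p *ₚ r) k                             ≡⟨ cong (ℚ._+ coeffₚ (p *ₚ r) k) (ℚ.*-zeroˡ (coeffₚ r (suc k))) ⟨
    0ℚ ℚ.* coeffₚ r (suc k) ℚ.+ coeffₚ (p *ₚ r) k        ≡⟨ coeffₚ-∷-* 0ℚ p r (suc k) ⟨
    coeffₚ ((0ℚ ∷ p) *ₚ r) (suc k)                       ≡⟨ eq ⟩
    0ℚ                                                   ∎)
    where open ≡-Reasoning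
... | no a≢0 = byRight r r≢0
  where
  byRight : ∀ r → NonZeroₚ r → NonZeroₚ ((a ∷ p) *ₚ r)
  byRight []      (_ , r≢0) = contradiction refl r≢0
  byRight (b ∷ r) r≢0 with b ℚ.≟ 0ℚ
  ... | no b≢0 = 0 , λ eq → *-nonZero a≢0 b≢0
                       (trans (sym (coeffₚ-*-zero (a ∷ p) (b ∷ r))) eq)
  byRight (b ∷ r) (zero  , r≢0) | yes refl = contradiction refl r≢0
  byRight (b ∷ r) (suc m , r≢0) | yes refl with byRight r (m , r≢0)
  ... | k , ≢0 = suc k , λ eq → ≢0 (trans (sym (coeffₚ-*-shift (a ∷ p) r k)) eq)

-- ℚ(q) as the fractions of ℚ[q]; they need not be reduced, and _≈_ below is
-- equality of the rational functions.

infix 5 _/_⟨_⟩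

record ℚ⟨q⟩ : Set where
  constructor _/_⟨_⟩
  field
    num   : Poly
    den   : Poly
    den≢0 : NonZeroₚ den

open ℚ⟨q⟩ public

fromPoly : Poly → ℚ⟨q⟩
fromPoly p = p / [ 1ℚ ] ⟨ 0 , ℚ.1≢0 ⟩

fromℚ : ℚ → ℚ⟨q⟩
fromℚ a = fromPoly [ a ]

q : ℚ⟨q⟩
q = fromPoly (0ℚ ∷ 1ℚ ∷ [])

ℚ⟨q⟩-rawRing : RawRing 0ℓ 0ℓ
ℚ⟨q⟩-rawRing = record
  { Carrier = ℚ⟨q⟩
  ; _≈_     = λ x y → num x *ₚ den y ≈ₚ num y *ₚ den x
  ; _+_     = λ x y → num x *ₚ den y +ₚ num y *ₚ den x / den x *ₚ den y
                        ⟨ *ₚ-nonZero (den x) (den y) (den≢0 x) (den≢0 y) ⟩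
  ; _*_     = λ x y → num x *ₚ num y / den x *ₚ den y
                        ⟨ *ₚ-nonZero (den x) (den y) (den≢0 x) (den≢0 y) ⟩
  ; -_      = λ x → -ₚ num x / den x ⟨ den≢0 x ⟩
  ; 0#      = fromℚ 0ℚ
  ; 1#      = fromℚ 1ℚ
  }

open RawRing ℚ⟨q⟩-rawRing public
  using (_≈_; _+_; _*_; -_; 0#; 1#; rawSemiring)
open RawSemiringDefs rawSemiring public using (_^_)

infixl 6 _-_

_-_ : ℚ⟨q⟩ → ℚ⟨q⟩ → ℚ⟨q⟩
x - y = x + (- y)

inverse : (x : ℚ⟨q⟩) → NonZeroₚ (num x) → ℚ⟨q⟩
inverse x x≢0 = den x / num x ⟨ x≢0 ⟩

den-q^-zero : ∀ i → coeffₚ (den (q ^ i)) 0 ≡ 1ℚ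
den-q^-zero zero    = refl
den-q^-zero (suc i) =
  trans (coeffₚ-*-zero [ 1ℚ ] (den (q ^ i))) (trans (ℚ.*-identityˡ _) (den-q^-zero i))

num-q^-zero : ∀ i → coeffₚ (num (q ^ suc i)) 0 ≡ 0ℚ
num-q^-zero i = trans (coeffₚ-*-zero (0ℚ ∷ 1ℚ ∷ []) (num (q ^ i))) (ℚ.*-zeroˡ (coeffₚ (num (q ^ i)) 0))

1-q^suc≢0 : ∀ i → NonZeroₚ (num (1# - q ^ suc i))
1-q^suc≢0 i = 0 , λ eq → ℚ.1≢0 (trans (sym constantTerm) eq)
  where
  open ≡-Reasoning
  n d : Poly
  n = num (q ^ suc i)
  d = den (q ^ suc i)
  neg-zero : ∀ p → coeffₚ p 0 ≡ 0ℚ → coeffₚ (-ₚ p) 0 ≡ 0ℚ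
  neg-zero []      _    = refl
  neg-zero (_ ∷ _) refl = refl
  constantTerm : coeffₚ (num (1# - q ^ suc i)) 0 ≡ 1ℚ
  constantTerm = begin
    coeffₚ ([ 1ℚ ] *ₚ d +ₚ (-ₚ n) *ₚ [ 1ℚ ]) 0
      ≡⟨ coeffₚ-+ ([ 1ℚ ] *ₚ d) ((-ₚ n) *ₚ [ 1ℚ ]) 0 ⟩
    coeffₚ ([ 1ℚ ] *ₚ d) 0 ℚ.+ coeffₚ ((-ₚ n) *ₚ [ 1ℚ ]) 0
      ≡⟨ cong₂ ℚ._+_ (coeffₚ-*-zero [ 1ℚ ] d) (coeffₚ-*-zero (-ₚ n) [ 1ℚ ]) ⟩
    1ℚ ℚ.* coeffₚ d 0 ℚ.+ coeffₚ (-ₚ n) 0 ℚ.* 1ℚ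
      ≡⟨ cong₂ (λ x y → 1ℚ ℚ.* x ℚ.+ y ℚ.* 1ℚ) (den-q^-zero (suc i)) (neg-zero n (num-q^-zero i)) ⟩
    1ℚ ∎

sumₖ productₖ : List ℚ⟨q⟩ → ℚ⟨q⟩
sumₖ     = foldr _+_ 0#
productₖ = foldr _*_ 1#

-- F : PowerSeries is Σₖ F k · t^k in ℚ(q)[[t]].

PowerSeries : Set
PowerSeries = ℕ → ℚ⟨q⟩

infix 4 _≋_

_≋_ : PowerSeries → PowerSeries → Set
F ≋ G = ∀ k → F k ≈ G k

Θ : PowerSeries → PowerSeries
Θ F k = q ^ k * F k

-- (1 - q^i Θ) / (1 - q^i) for i = suc j.
factor : ℕ → PowerSeries → PowerSeries
factor j F k = inverse (1# - q ^ suc j) (1-q^suc≢0 j) * (F k - q ^ suc j * Θ F k)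

Q : ℕ → PowerSeries → PowerSeries
Q zero    = id
Q (suc r) = Q r ∘ factor r

-- An exponent list (a₁ ∷ … ∷ aₙ ∷ []) stands for the monomial z₁^a₁ ⋯ zₙ^aₙ,
-- so lists differing in trailing zeros stand for the same monomial.

Exponents : Set
Exponents = List ℕ

-- The composition (α₁ , … , αₗ) of nonzero exponents, in order of the
-- variables, of a monomial z_{i₁}^α₁ ⋯ z_{iₗ}^αₗ with i₁ < ⋯ < iₗ.
composition : Exponents → List ℕ
composition = filter (0 <?_)

sumOver : {A : Set} → List A → (A → ℚ) → ℚ
sumOver xs f = foldr (λ x s → f x ℚ.+ s) 0ℚ xs

-- All factorisations of a monomial into an ordered pair of monomials.
splits : Exponents → List (Exponents × Exponents)
splits []      = [ ([] , []) ]
splits (n ∷ a) =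
  concatMap (λ i → map (λ (b , c) → (i ∷ b , (n ∸ i) ∷ c)) (splits a)) (upTo (suc n))

-- Formal series in z₁, z₂, … over ℚ, given by their coefficients.  Appending
-- zeros does not change the composition, so quasisymmetric also makes coeff
-- well defined on monomials.

record QSym (N : ℕ) : Set where
  field
    coeff          : Exponents → ℚ
    homogeneous    : ∀ a → sum a ≢ N → coeff a ≡ 0ℚ
    quasisymmetric : ∀ a b → composition a ≡ composition b → coeff a ≡ coeff b

open QSym public

sumOver-cong : {A : Set} {f g : A → ℚ} (xs : List A) →
  (∀ x → f x ≡ g x) → sumOver xs f ≡ sumOver xs g
sumOver-cong []       f≗g = refl
sumOver-cong (x ∷ xs) f≗g = cong₂ ℚ._+_ (f≗g x) (sumOver-cong xs f≗g)

sumOver-zero : {A : Set} {f : A → ℚ} {xs : List A} →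
  All (λ x → f x ≡ 0ℚ) xs → sumOver xs f ≡ 0ℚ
sumOver-zero []       = refl
sumOver-zero (p ∷ ps) = cong₂ ℚ._+_ p (sumOver-zero ps)

sumOver-++ : {A : Set} (f : A → ℚ) (xs ys : List A) →
  sumOver (xs ++ ys) f ≡ sumOver xs f ℚ.+ sumOver ys f
sumOver-++ f []       ys = sym (ℚ.+-identityˡ _)
sumOver-++ f (x ∷ xs) ys =
  trans (cong (f x ℚ.+_) (sumOver-++ f xs ys)) (sym (ℚ.+-assoc (f x) _ _))

sumOver-map : {A B : Set} (f : B → ℚ) (g : A → B) (xs : List A) →
  sumOver (map g xs) f ≡ sumOver xs (f ∘ g)
sumOver-map f g []       = refl
sumOver-map f g (x ∷ xs) = cong (f (g x) ℚ.+_) (sumOver-map f g xs)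

sumOver-concatMap : {A B : Set} (f : B → ℚ) (g : A → List B) (xs : List A) →
  sumOver (concatMap g xs) f ≡ sumOver xs (λ x → sumOver (g x) f)
sumOver-concatMap f g []       = refl
sumOver-concatMap f g (x ∷ xs) =
  trans (sumOver-++ f (g x) (concatMap g xs))
        (cong (sumOver (g x) f ℚ.+_) (sumOver-concatMap f g xs))

sumOver-splits : (F : Exponents × Exponents → ℚ) (n : ℕ) (a : Exponents) →
  sumOver (splits (n ∷ a)) F ≡
  sumOver (upTo (suc n)) (λ i → sumOver (splits a) (λ (b , c) → F (i ∷ b , (n ∸ i) ∷ c)))
sumOver-splits F n a =
  trans (sumOver-concatMap F (λ i → map (cons i) (splits a)) (upTo (suc n)))
        (sumOver-cong (upTo (suc n)) (λ i → sumOver-map F (cons i) (splits a)))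
  where
  cons : ℕ → Exponents × Exponents → Exponents × Exponents
  cons i (b , c) = i ∷ b , (n ∸ i) ∷ c

composition-idem : ∀ a → composition (composition a) ≡ composition a
composition-idem = filter-idem (0 <?_)

composition-∷ : ∀ i a → composition (i ∷ composition a) ≡ composition (i ∷ a)
composition-∷ zero    a = composition-idem a
composition-∷ (suc i) a = cong (suc i ∷_) (composition-idem a)

sumOver-splits-composition : (F : Exponents × Exponents → ℚ) →
  (∀ b c → F (b , c) ≡ F (composition b , composition c)) →
  ∀ a → sumOver (splits a) F ≡ sumOver (splits (composition a)) F
sumOver-splits-composition F inv []          = refl
sumOver-splits-composition F inv (zero ∷ a)  = begin
  sumOver (splits (0 ∷ a)) F
    ≡⟨ sumOver-splits F 0 a ⟩
  sumOver (splits a) (λ (b , c) → F (0 ∷ b , 0 ∷ c)) ℚ.+ 0ℚ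
    ≡⟨ ℚ.+-identityʳ _ ⟩
  sumOver (splits a) (λ (b , c) → F (0 ∷ b , 0 ∷ c))
    ≡⟨ sumOver-cong (splits a) (λ (b , c) → trans (inv (0 ∷ b) (0 ∷ c)) (sym (inv b c))) ⟩
  sumOver (splits a) F
    ≡⟨ sumOver-splits-composition F inv a ⟩
  sumOver (splits (composition a)) F ∎
  where open ≡-Reasoning
sumOver-splits-composition F inv (suc n ∷ a) = begin
  sumOver (splits (suc n ∷ a)) F
    ≡⟨ sumOver-splits F (suc n) a ⟩
  sumOver (upTo (suc (suc n))) (λ i → sumOver (splits a) (G i))
    ≡⟨ sumOver-cong (upTo (suc (suc n))) (λ i → sumOver-splits-composition (G i) (G-inv i) a) ⟩
  sumOver (upTo (suc (suc n))) (λ i → sumOver (splits (composition a)) (G i))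
    ≡⟨ sumOver-splits F (suc n) (composition a) ⟨
  sumOver (splits (suc n ∷ composition a)) F ∎
  where
  open ≡-Reasoning
  G : ℕ → Exponents × Exponents → ℚ
  G i (b , c) = F (i ∷ b , (suc n ∸ i) ∷ c)
  G-inv : ∀ i b c → G i (b , c) ≡ G i (composition b , composition c)
  G-inv i b c = trans (inv _ _) (trans
    (sym (cong₂ (λ x y → F (x , y)) (composition-∷ i b) (composition-∷ (suc n ∸ i) c)))
    (sym (inv _ _)))

upTo-≤ : ∀ n → All (ℕ._≤ n) (upTo (suc n))
upTo-≤ n = All.applyUpTo⁺₁ id (suc n) ℕ.s≤s⁻¹

DegreesAddTo : ℕ → Exponents × Exponents → Set
DegreesAddTo n (b , c) = sum b ℕ.+ sum c ≡ n

splits-sum : ∀ a → All (DegreesAddTo (sum a)) (splits a)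
splits-sum []      = refl ∷ []
splits-sum (n ∷ a) = All.concat⁺ (All.map⁺ (All.map
  (λ {i} i≤n → All.map⁺ (All.map (λ {bc} → step i i≤n bc) (splits-sum a))) (upTo-≤ n)))
  where
  open ≡-Reasoning
  interchange : ∀ w x y z → (w ℕ.+ x) ℕ.+ (y ℕ.+ z) ≡ (w ℕ.+ y) ℕ.+ (x ℕ.+ z)
  interchange w x y z = begin
    (w ℕ.+ x) ℕ.+ (y ℕ.+ z)  ≡⟨ ℕ.+-assoc w x _ ⟩
    w ℕ.+ (x ℕ.+ (y ℕ.+ z))  ≡⟨ cong (w ℕ.+_) (ℕ.+-assoc x y z) ⟨
    w ℕ.+ ((x ℕ.+ y) ℕ.+ z)  ≡⟨ cong (λ u → w ℕ.+ (u ℕ.+ z)) (ℕ.+-comm x y) ⟩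
    w ℕ.+ ((y ℕ.+ x) ℕ.+ z)  ≡⟨ cong (w ℕ.+_) (ℕ.+-assoc y x z) ⟩
    w ℕ.+ (y ℕ.+ (x ℕ.+ z))  ≡⟨ ℕ.+-assoc w y _ ⟨
    (w ℕ.+ y) ℕ.+ (x ℕ.+ z)  ∎
  step : ∀ i → i ℕ.≤ n → ∀ ((b , c) : Exponents × Exponents) → DegreesAddTo (sum a) (b , c) →
    DegreesAddTo (sum (n ∷ a)) (i ∷ b , (n ∸ i) ∷ c)
  step i i≤n (b , c) eq =
    trans (interchange i (sum b) (n ∸ i) (sum c)) (cong₂ ℕ._+_ (ℕ.m+[n∸m]≡n i≤n) eq)

infixl 7 _·_

_·_ : ∀ {M N} → QSym M → QSym N → QSym (M ℕ.+ N)
_·_ {M} {N} f g = record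
  { coeff          = λ a → sumOver (splits a) term
  ; homogeneous    = λ a a≢ → sumOver-zero (All.map (λ {bc} → vanish a a≢ bc) (splits-sum a))
  ; quasisymmetric = λ a b eq → trans (sumOver-splits-composition term term-inv a)
      (trans (cong (λ c → sumOver (splits c) term) eq) (sym (sumOver-splits-composition term term-inv b)))
  }
  where
  term : Exponents × Exponents → ℚ
  term (b , c) = coeff f b ℚ.* coeff g c
  term-inv : ∀ b c → term (b , c) ≡ term (composition b , composition c)
  term-inv b c = cong₂ ℚ._*_ (quasisymmetric f b _ (sym (composition-idem b)))
                             (quasisymmetric g c _ (sym (composition-idem c)))
  vanish : ∀ a → sum a ≢ M ℕ.+ N → ∀ bc → DegreesAddTo (sum a) bc → term bc ≡ 0ℚ
  vanish a a≢ (b , c) eq with sum b ℕ.≟ M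
  ... | no  b≢ = trans (cong (ℚ._* coeff g c) (homogeneous f b b≢)) (ℚ.*-zeroˡ (coeff g c))
  ... | yes b≡ = trans (cong (coeff f b ℚ.*_) (homogeneous g c c≢)) (ℚ.*-zeroʳ (coeff f b))
    where
    c≢ : sum c ≢ N
    c≢ c≡ = a≢ (trans (sym eq) (cong₂ ℕ._+_ b≡ c≡))

-- All i₁ ≤ ⋯ ≤ iᵣ in Fin n: either i₁ is the least index, or no index is.
weaklyIncreasing : (r n : ℕ) → List (List (Fin n))
weaklyIncreasing zero    n       = [ [] ]
weaklyIncreasing (suc r) zero    = []
weaklyIncreasing (suc r) (suc n) =
  map (zero ∷_) (weaklyIncreasing r (suc n)) ++ map (map suc) (weaklyIncreasing (suc r) n)

multiplicity : ∀ {n} → Fin n → List (Fin n) → ℕ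
multiplicity i is = length (filter (i Fin.≟_) is)

-- The exponents of z_{i₁} ⋯ z_{iᵣ}.
monomial : ∀ {n} → List (Fin n) → Exponents
monomial is = tabulate (λ i → multiplicity i is)

indicator : Exponents → Exponents → ℚ
indicator m a = if does (≡-dec ℕ._≟_ m a) then 1ℚ else 0ℚ

-- Variables beyond the length of a do not occur in the monomial a, so only
-- sequences of indices up to that length contribute to its coefficient.
h-coeff : ℕ → Exponents → ℚ
h-coeff r a = sumOver (weaklyIncreasing r (length a)) (λ is → indicator (monomial is) a)

multiplicity-zero : ∀ {n} (is : List (Fin n)) → multiplicity zero (map suc is) ≡ 0
multiplicity-zero []       = refl
multiplicity-zero (_ ∷ is) = multiplicity-zero is

multiplicity-suc : ∀ {n} (i : Fin n) is → multiplicity (suc i) (map suc is) ≡ multiplicity i is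
multiplicity-suc i []       = refl
multiplicity-suc i (j ∷ is) with i Fin.≟ j
... | yes _ = cong suc (multiplicity-suc i is)
... | no  _ = multiplicity-suc i is

monomial-suc : ∀ {n} (is : List (Fin n)) → monomial (map suc is) ≡ 0 ∷ monomial is
monomial-suc is = cong₂ _∷_ (multiplicity-zero is) (tabulate-cong (λ i → multiplicity-suc i is))

-- Every monomial of degree r arises from exactly one sequence.
h-coeff-degree : ∀ r a → h-coeff r a ≡ (if does (sum a ℕ.≟ r) then 1ℚ else 0ℚ)
h-coeff-degree zero    a           = trans (ℚ.+-identityʳ _) (constant a)
  where
  constant : ∀ a → indicator (monomial {length a} []) a ≡ (if does (sum a ℕ.≟ 0) then 1ℚ else 0ℚ)
  constant []          = refl
  constant (zero  ∷ a) = constant a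
  constant (suc x ∷ a) = refl
h-coeff-degree (suc r) []          = refl
h-coeff-degree (suc r) (zero ∷ a)  = begin
  h-coeff (suc r) (0 ∷ a)
    ≡⟨ sumOver-++ ind (map (zero ∷_) (weaklyIncreasing r (suc n))) _ ⟩
  sumOver (map (zero ∷_) (weaklyIncreasing r (suc n))) ind ℚ.+
    sumOver (map (map suc) (weaklyIncreasing (suc r) n)) ind
    ≡⟨ cong₂ ℚ._+_ (sumOver-map ind (zero ∷_) (weaklyIncreasing r (suc n)))
                   (sumOver-map ind (map suc) (weaklyIncreasing (suc r) n)) ⟩
  sumOver (weaklyIncreasing r (suc n)) (λ _ → 0ℚ) ℚ.+
    sumOver (weaklyIncreasing (suc r) n) (ind ∘ map suc)
    ≡⟨ cong₂ ℚ._+_ (sumOver-zero (All.universal (λ _ → refl) (weaklyIncreasing r (suc n))))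
                   (sumOver-cong (weaklyIncreasing (suc r) n)
                     (λ is → cong (λ m → indicator m (0 ∷ a)) (monomial-suc is))) ⟩
  0ℚ ℚ.+ h-coeff (suc r) a
    ≡⟨ ℚ.+-identityˡ _ ⟩
  h-coeff (suc r) a
    ≡⟨ h-coeff-degree (suc r) a ⟩
  (if does (sum a ℕ.≟ suc r) then 1ℚ else 0ℚ) ∎
  where
  open ≡-Reasoning
  n : ℕ
  n = length a
  ind : List (Fin (suc n)) → ℚ
  ind is = indicator (monomial is) (0 ∷ a)
h-coeff-degree (suc r) (suc x ∷ a) = begin
  h-coeff (suc r) (suc x ∷ a)
    ≡⟨ sumOver-++ ind (map (zero ∷_) (weaklyIncreasing r (suc n))) _ ⟩
  sumOver (map (zero ∷_) (weaklyIncreasing r (suc n))) ind ℚ.+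
    sumOver (map (map suc) (weaklyIncreasing (suc r) n)) ind
    ≡⟨ cong₂ ℚ._+_ (sumOver-map ind (zero ∷_) (weaklyIncreasing r (suc n)))
                   (sumOver-map ind (map suc) (weaklyIncreasing (suc r) n)) ⟩
  h-coeff r (x ∷ a) ℚ.+ sumOver (weaklyIncreasing (suc r) n) (ind ∘ map suc)
    ≡⟨ cong (h-coeff r (x ∷ a) ℚ.+_) (sumOver-zero (All.universal
         (λ is → cong (λ m → indicator m (suc x ∷ a)) (monomial-suc is)) (weaklyIncreasing (suc r) n))) ⟩
  h-coeff r (x ∷ a) ℚ.+ 0ℚ
    ≡⟨ ℚ.+-identityʳ _ ⟩
  h-coeff r (x ∷ a)
    ≡⟨ h-coeff-degree r (x ∷ a) ⟩
  (if does (x ℕ.+ sum a ℕ.≟ r) then 1ℚ else 0ℚ) ∎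
  where
  open ≡-Reasoning
  n : ℕ
  n = length a
  ind : List (Fin (suc n)) → ℚ
  ind is = indicator (monomial is) (suc x ∷ a)

sum-composition : ∀ a → sum (composition a) ≡ sum a
sum-composition []          = refl
sum-composition (zero ∷ a)  = sum-composition a
sum-composition (suc x ∷ a) = cong (suc x ℕ.+_) (sum-composition a)

h : (r : ℕ) → QSym r
h r = record
  { coeff          = h-coeff r
  ; homogeneous    = λ a a≢r → trans (h-coeff-degree r a)
      (cong (if_then 1ℚ else 0ℚ) (dec-false (sum a ℕ.≟ r) a≢r))
  ; quasisymmetric = λ a b eq → trans (h-coeff-degree r a) (trans
      (cong (λ s → if does (s ℕ.≟ r) then 1ℚ else 0ℚ)
        (trans (sym (sum-composition a)) (trans (cong sum eq) (sum-composition b))))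
      (sym (h-coeff-degree r b)))
  }

-- The exponent lists of the monomials of degree N in n variables.
monomials : (N n : ℕ) → List Exponents
monomials N       (suc n) = concatMap (λ i → map (i ∷_) (monomials (N ∸ i) n)) (upTo (suc N))
monomials zero    zero    = [ [] ]
monomials (suc N) zero    = []

-- The value at z₁, …, zₙ = xs and zᵢ = 0 for i > n; monomials involving a
-- variable beyond zₙ vanish there, so the sum is finite.
evaluate : ∀ {N} → QSym N → List ℚ⟨q⟩ → ℚ⟨q⟩
evaluate {N} f xs =
  sumₖ (map (λ a → fromℚ (coeff f a) * productₖ (zipWith _^_ xs a)) (monomials N (length xs)))

-- downFrom (suc k) is k ∷ k - 1 ∷ … ∷ 0 ∷ [].
Ψ : (N : ℕ) → QSym N → PowerSeries
Ψ N f k = evaluate f (map (q ^_) (downFrom (suc k)))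

{-# OPTIONS --safe #-}

-- Evaluation at finitely many variables is multiplicative, and the value of h_r
-- at (q^k, …, q, 1) is the Gaussian binomial [k+r choose r], so the left side
-- multiplies the coefficient of t^k by [k+r choose r].  The operator Q_r is
-- diagonal on powers of t as well: it multiplies t^k by
-- ∏_{i=1}^{r} (1 - q^{i+k})/(1 - q^i), which is the same Gaussian binomial.
-- Diagonal operators commute.

module Submission where

open import Level using (0ℓ)
open import Algebra.Bundles using (CommutativeSemiring; CommutativeRing)
open import Algebra.Consequences.Setoid using (comm∧idˡ⇒id; comm∧invˡ⇒inv; comm∧distrˡ⇒distr)
open import Data.Rational using (ℚ; 0ℚ; 1ℚ)
import Data.Rational as ℚ
import Data.Rational.Properties as ℚ
open import Data.Bool.Base using (if_then_else_)
open import Relation.Nullary using (yes; no; contradiction)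
open import Relation.Nullary.Decidable using (dec-true)
open import Relation.Binary.Bundles using (Setoid)
open import Function.Base using (_∘_; id; flip)
open import Data.Nat using (ℕ; zero; suc; _∸_)
import Data.Nat as ℕ
import Data.Nat.Properties as ℕ
open import Data.Nat.ListAction using (sum)
open import Data.List.Base
  using (List; []; _∷_; _++_; map; foldr; concatMap; length; upTo; applyUpTo; zipWith; downFrom)
open import Data.Product using (_×_; _,_)
open import Relation.Binary.PropositionalEquality as ≡
  using (_≡_; _≢_; module ≡-Reasoning)
open import Defs using (Exponents; splits; monomials)

module Antidiagonal {c ℓ} (R : CommutativeSemiring c ℓ) where

  open CommutativeSemiring R
  open import Relation.Binary.Reasoning.Setoid setoid

  antidiagonal : ℕ → (ℕ → ℕ → Carrier) → Carrier
  antidiagonal zero    φ = φ 0 0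
  antidiagonal (suc n) φ = φ 0 (suc n) + antidiagonal n (φ ∘ suc)

  antidiagonal-cong : ∀ n {φ ψ} → (∀ i j → i ℕ.+ j ≡ n → φ i j ≈ ψ i j) →
    antidiagonal n φ ≈ antidiagonal n ψ
  antidiagonal-cong zero    φ≈ψ = φ≈ψ 0 0 ≡.refl
  antidiagonal-cong (suc n) φ≈ψ = +-cong (φ≈ψ 0 (suc n) ≡.refl)
    (antidiagonal-cong n (λ i j i+j≡n → φ≈ψ (suc i) j (≡.cong suc i+j≡n)))

  antidiagonal-zero : ∀ n {φ} → (∀ i j → i ℕ.+ j ≡ n → φ i j ≈ 0#) → antidiagonal n φ ≈ 0#
  antidiagonal-zero zero    φ≈0 = φ≈0 0 0 ≡.refl
  antidiagonal-zero (suc n) φ≈0 = trans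
    (+-cong (φ≈0 0 (suc n) ≡.refl)
            (antidiagonal-zero n (λ i j i+j≡n → φ≈0 (suc i) j (≡.cong suc i+j≡n))))
    (+-identityˡ 0#)

  +-interchange : ∀ w x y z → (w + x) + (y + z) ≈ (w + y) + (x + z)
  +-interchange w x y z = begin
    (w + x) + (y + z)  ≈⟨ +-assoc w x (y + z) ⟩
    w + (x + (y + z))  ≈⟨ +-congˡ (+-assoc x y z) ⟨
    w + ((x + y) + z)  ≈⟨ +-congˡ (+-congʳ (+-comm x y)) ⟩
    w + ((y + x) + z)  ≈⟨ +-congˡ (+-assoc y x z) ⟩
    w + (y + (x + z))  ≈⟨ +-assoc w y (x + z) ⟨
    (w + y) + (x + z)  ∎

  antidiagonal-+ : ∀ n φ ψ →
    antidiagonal n (λ i j → φ i j + ψ i j) ≈ antidiagonal n φ + antidiagonal n ψ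
  antidiagonal-+ zero    φ ψ = refl
  antidiagonal-+ (suc n) φ ψ = trans (+-congˡ (antidiagonal-+ n (φ ∘ suc) (ψ ∘ suc)))
    (+-interchange _ _ _ _)

  antidiagonal-*ˡ : ∀ n x φ → antidiagonal n (λ i j → x * φ i j) ≈ x * antidiagonal n φ
  antidiagonal-*ˡ zero    x φ = refl
  antidiagonal-*ˡ (suc n) x φ = trans (+-congˡ (antidiagonal-*ˡ n x (φ ∘ suc))) (sym (distribˡ x _ _))

  antidiagonal-*ʳ : ∀ n x φ → antidiagonal n (λ i j → φ i j * x) ≈ antidiagonal n φ * x
  antidiagonal-*ʳ zero    x φ = refl
  antidiagonal-*ʳ (suc n) x φ = trans (+-congˡ (antidiagonal-*ʳ n x (φ ∘ suc))) (sym (distribʳ x _ _))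

  antidiagonal-sucʳ : ∀ n φ →
    antidiagonal (suc n) φ ≈ antidiagonal n (λ i j → φ i (suc j)) + φ (suc n) 0
  antidiagonal-sucʳ zero    φ = refl
  antidiagonal-sucʳ (suc n) φ =
    trans (+-congˡ (antidiagonal-sucʳ n (φ ∘ suc))) (sym (+-assoc _ _ _))

  antidiagonal-comm : ∀ n φ → antidiagonal n φ ≈ antidiagonal n (flip φ)
  antidiagonal-comm zero    φ = refl
  antidiagonal-comm (suc n) φ = begin
    φ 0 (suc n) + antidiagonal n (φ ∘ suc)         ≈⟨ +-congˡ (antidiagonal-comm n (φ ∘ suc)) ⟩
    φ 0 (suc n) + antidiagonal n (flip (φ ∘ suc))  ≈⟨ +-comm _ _ ⟩
    antidiagonal n (flip (φ ∘ suc)) + φ 0 (suc n)  ≈⟨ antidiagonal-sucʳ n (flip φ) ⟨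
    antidiagonal (suc n) (flip φ)                  ∎

  antidiagonal-assoc : ∀ n (φ : ℕ → ℕ → ℕ → Carrier) →
    antidiagonal n (λ m l → antidiagonal m (λ i j → φ i j l)) ≈
    antidiagonal n (λ i p → antidiagonal p (φ i))
  antidiagonal-assoc zero    φ = refl
  antidiagonal-assoc (suc n) φ = begin
    φ 0 0 (suc n) +
      antidiagonal n (λ m l → φ 0 (suc m) l + antidiagonal m (λ i j → φ (suc i) j l))
      ≈⟨ +-congˡ (antidiagonal-+ n _ _) ⟩
    φ 0 0 (suc n) + (antidiagonal n (λ m l → φ 0 (suc m) l) +
      antidiagonal n (λ m l → antidiagonal m (λ i j → φ (suc i) j l)))
      ≈⟨ +-assoc _ _ _ ⟨
    antidiagonal (suc n) (φ 0) +
      antidiagonal n (λ m l → antidiagonal m (λ i j → φ (suc i) j l))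
      ≈⟨ +-congˡ (antidiagonal-assoc n (φ ∘ suc)) ⟩
    antidiagonal (suc n) (φ 0) + antidiagonal n (λ i p → antidiagonal p (φ (suc i))) ∎

  antidiagonal-exchange : ∀ n (φ : ℕ → ℕ → ℕ → Carrier) →
    antidiagonal n (λ i p → antidiagonal p (φ i)) ≈
    antidiagonal n (λ j p → antidiagonal p (λ i l → φ i j l))
  antidiagonal-exchange n φ = begin
    antidiagonal n (λ i p → antidiagonal p (φ i))
      ≈⟨ antidiagonal-assoc n φ ⟨
    antidiagonal n (λ m l → antidiagonal m (λ i j → φ i j l))
      ≈⟨ antidiagonal-cong n (λ m l _ → antidiagonal-comm m (λ i j → φ i j l)) ⟩
    antidiagonal n (λ m l → antidiagonal m (λ j i → φ i j l))
      ≈⟨ antidiagonal-assoc n (λ j i l → φ i j l) ⟩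
    antidiagonal n (λ j p → antidiagonal p (λ i l → φ i j l)) ∎

  antidiagonal-single : ∀ r n φ → (∀ i j → i ≢ r → φ i j ≈ 0#) →
    antidiagonal (r ℕ.+ n) φ ≈ φ r n
  antidiagonal-single zero zero    φ φ≈0 = refl
  antidiagonal-single zero (suc n) φ φ≈0 =
    trans (+-congˡ (antidiagonal-zero n (λ i j _ → φ≈0 (suc i) j λ ()))) (+-identityʳ _)
  antidiagonal-single (suc r) n    φ φ≈0 = trans
    (+-cong (φ≈0 0 _ λ ())
            (antidiagonal-single r n (φ ∘ suc) (λ i j i≢r → φ≈0 (suc i) j (i≢r ∘ ℕ.suc-injective))))
    (+-identityˡ _)

module Evaluation {c ℓ} (R : CommutativeSemiring c ℓ) where

  open CommutativeSemiring R
  open Antidiagonal R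
  open import Algebra.Properties.CommutativeSemiring.Exp R using (_^_; ^-homo-*)
  open import Relation.Binary.Reasoning.Setoid setoid
  open import Algebra.Solver.Ring.NaturalCoefficients.Default R

  ∑ : {A : Set} → List A → (A → Carrier) → Carrier
  ∑ xs f = foldr _+_ 0# (map f xs)

  ∑-cong : {A : Set} {f g : A → Carrier} (xs : List A) → (∀ x → f x ≈ g x) → ∑ xs f ≈ ∑ xs g
  ∑-cong []       f≈g = refl
  ∑-cong (x ∷ xs) f≈g = +-cong (f≈g x) (∑-cong xs f≈g)

  ∑-++ : {A : Set} (f : A → Carrier) (xs ys : List A) → ∑ (xs ++ ys) f ≈ ∑ xs f + ∑ ys f
  ∑-++ f []       ys = sym (+-identityˡ _)
  ∑-++ f (x ∷ xs) ys = trans (+-congˡ (∑-++ f xs ys)) (sym (+-assoc _ _ _))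

  ∑-map : {A B : Set} (f : B → Carrier) (g : A → B) (xs : List A) → ∑ (map g xs) f ≈ ∑ xs (f ∘ g)
  ∑-map f g []       = refl
  ∑-map f g (x ∷ xs) = +-congˡ (∑-map f g xs)

  ∑-concatMap : {A B : Set} (f : B → Carrier) (g : A → List B) (xs : List A) →
    ∑ (concatMap g xs) f ≈ ∑ xs (λ x → ∑ (g x) f)
  ∑-concatMap f g []       = refl
  ∑-concatMap f g (x ∷ xs) =
    trans (∑-++ f (g x) (concatMap g xs)) (+-congˡ (∑-concatMap f g xs))

  ∑-+ : {A : Set} (f g : A → Carrier) (xs : List A) → ∑ xs (λ x → f x + g x) ≈ ∑ xs f + ∑ xs g
  ∑-+ f g []       = sym (+-identityˡ 0#)
  ∑-+ f g (x ∷ xs) = trans (+-congˡ (∑-+ f g xs)) (+-interchange _ _ _ _)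

  ∑-*ˡ : {A : Set} (y : Carrier) (f : A → Carrier) (xs : List A) →
    ∑ xs (λ x → y * f x) ≈ y * ∑ xs f
  ∑-*ˡ y f []       = sym (zeroʳ y)
  ∑-*ˡ y f (x ∷ xs) = trans (+-congˡ (∑-*ˡ y f xs)) (sym (distribˡ y _ _))

  ∑-applyUpTo : ∀ n (f : ℕ → Carrier) (g : ℕ → ℕ) φ →
    (∀ i j → i ℕ.+ j ≡ n → f (g i) ≈ φ i j) → ∑ (applyUpTo g (suc n)) f ≈ antidiagonal n φ
  ∑-applyUpTo zero    f g φ f≈φ = trans (+-identityʳ _) (f≈φ 0 0 ≡.refl)
  ∑-applyUpTo (suc n) f g φ f≈φ = +-cong (f≈φ 0 (suc n) ≡.refl)
    (∑-applyUpTo n f (g ∘ suc) (φ ∘ suc)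
      (λ i j i+j≡n → f≈φ (suc i) j (≡.cong suc i+j≡n)))

  ∑-upTo : ∀ n φ → ∑ (upTo (suc n)) (λ i → φ i (n ∸ i)) ≈ antidiagonal n φ
  ∑-upTo n φ = ∑-applyUpTo n _ id φ
    (λ { i j ≡.refl → reflexive (≡.cong (φ i) (ℕ.m+n∸m≡n i j)) })

  convolution : (c d : Exponents → Carrier) → Exponents → Carrier
  convolution c d a = ∑ (splits a) (λ (b , b′) → c b * d b′)

  convolution-∷ : ∀ c d n a → convolution c d (n ∷ a) ≈
    antidiagonal n (λ i j → convolution (c ∘ (i ∷_)) (d ∘ (j ∷_)) a)
  convolution-∷ c d n a = begin
    ∑ (splits (n ∷ a)) (λ (b , b′) → c b * d b′)
      ≈⟨ ∑-concatMap _ (λ i → map (λ (b , b′) → (i ∷ b , (n ∸ i) ∷ b′)) (splits a)) (upTo (suc n)) ⟩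
    ∑ (upTo (suc n)) (λ i →
      ∑ (map (λ (b , b′) → (i ∷ b , (n ∸ i) ∷ b′)) (splits a)) (λ (b , b′) → c b * d b′))
      ≈⟨ ∑-cong (upTo (suc n)) (λ i → ∑-map _ _ (splits a)) ⟩
    ∑ (upTo (suc n)) (λ i → convolution (c ∘ (i ∷_)) (d ∘ ((n ∸ i) ∷_)) a)
      ≈⟨ ∑-upTo n (λ i j → convolution (c ∘ (i ∷_)) (d ∘ (j ∷_)) a) ⟩
    antidiagonal n (λ i j → convolution (c ∘ (i ∷_)) (d ∘ (j ∷_)) a) ∎

  power : List Carrier → Exponents → Carrier
  power xs a = foldr _*_ 1# (zipWith _^_ xs a)

  -- The degree N part of the series with coefficients c, at z₁ , … , zₙ = xs.
  eval : (Exponents → Carrier) → ℕ → List Carrier → Carrier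
  eval c N xs = ∑ (monomials N (length xs)) (λ a → c a * power xs a)

  eval-∷ : ∀ c N x xs →
    eval c N (x ∷ xs) ≈ antidiagonal N (λ i j → x ^ i * eval (c ∘ (i ∷_)) j xs)
  eval-∷ c N x xs = begin
    eval c N (x ∷ xs)
      ≈⟨ ∑-concatMap _ (λ i → map (i ∷_) (monomials (N ∸ i) (length xs))) (upTo (suc N)) ⟩
    ∑ (upTo (suc N)) (λ i → ∑ (map (i ∷_) (monomials (N ∸ i) (length xs))) (λ a → c a * power (x ∷ xs) a))
      ≈⟨ ∑-cong (upTo (suc N)) (λ i → slice i (monomials (N ∸ i) (length xs))) ⟩
    ∑ (upTo (suc N)) (λ i → x ^ i * eval (c ∘ (i ∷_)) (N ∸ i) xs)
      ≈⟨ ∑-upTo N (λ i j → x ^ i * eval (c ∘ (i ∷_)) j xs) ⟩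
    antidiagonal N (λ i j → x ^ i * eval (c ∘ (i ∷_)) j xs) ∎
    where
    slice : ∀ i as → ∑ (map (i ∷_) as) (λ a → c a * power (x ∷ xs) a) ≈
      x ^ i * ∑ as (λ a → c (i ∷ a) * power xs a)
    slice i as = begin
      ∑ (map (i ∷_) as) (λ a → c a * power (x ∷ xs) a)
        ≈⟨ ∑-map _ (i ∷_) as ⟩
      ∑ as (λ a → c (i ∷ a) * (x ^ i * power xs a))
        ≈⟨ ∑-cong as (λ a → solve 3 (λ u v w → u :* (v :* w) := v :* (u :* w)) refl
                              (c (i ∷ a)) (x ^ i) (power xs a)) ⟩
      ∑ as (λ a → x ^ i * (c (i ∷ a) * power xs a))
        ≈⟨ ∑-*ˡ (x ^ i) _ as ⟩
      x ^ i * ∑ as (λ a → c (i ∷ a) * power xs a) ∎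

  eval-cong : ∀ {c d} N xs → (∀ a → sum a ≡ N → c a ≈ d a) → eval c N xs ≈ eval d N xs
  eval-cong zero    []       c≈d = +-congʳ (*-congʳ (c≈d [] ≡.refl))
  eval-cong (suc N) []       c≈d = refl
  eval-cong {c} {d} N (x ∷ xs) c≈d = begin
    eval c N (x ∷ xs)                                        ≈⟨ eval-∷ c N x xs ⟩
    antidiagonal N (λ i j → x ^ i * eval (c ∘ (i ∷_)) j xs)
      ≈⟨ antidiagonal-cong N (λ i j i+j≡N → *-congˡ {x ^ i} (eval-cong j xs
           (λ a a≡j → c≈d (i ∷ a) (≡.trans (≡.cong (i ℕ.+_) a≡j) i+j≡N)))) ⟩
    antidiagonal N (λ i j → x ^ i * eval (d ∘ (i ∷_)) j xs)  ≈⟨ eval-∷ d N x xs ⟨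
    eval d N (x ∷ xs)                                        ∎

  eval-zero : ∀ {c} N xs → (∀ a → sum a ≡ N → c a ≈ 0#) → eval c N xs ≈ 0#
  eval-zero {c} N xs c≈0 = begin
    eval c N xs                                    ≈⟨ eval-cong N xs (λ a a≡N → trans (c≈0 a a≡N) (sym (zeroˡ 0#))) ⟩
    ∑ as (λ a → 0# * 0# * power xs a)              ≈⟨ ∑-cong as (λ a → *-assoc 0# 0# (power xs a)) ⟩
    ∑ as (λ a → 0# * (0# * power xs a))            ≈⟨ ∑-*ˡ 0# (λ a → 0# * power xs a) as ⟩
    0# * ∑ as (λ a → 0# * power xs a)              ≈⟨ zeroˡ _ ⟩
    0#                                             ∎
    where as = monomials N (length xs)

  eval-antidiagonal : ∀ n (c : ℕ → ℕ → Exponents → Carrier) N xs →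
    eval (λ a → antidiagonal n (λ i j → c i j a)) N xs ≈ antidiagonal n (λ i j → eval (c i j) N xs)
  eval-antidiagonal zero    c N xs = refl
  eval-antidiagonal (suc n) c N xs = begin
    ∑ as (λ a → (c 0 (suc n) a + rest a) * power xs a)
      ≈⟨ ∑-cong as (λ a → distribʳ (power xs a) (c 0 (suc n) a) (rest a)) ⟩
    ∑ as (λ a → c 0 (suc n) a * power xs a + rest a * power xs a)
      ≈⟨ ∑-+ _ _ as ⟩
    eval (c 0 (suc n)) N xs + eval rest N xs
      ≈⟨ +-congˡ (eval-antidiagonal n (c ∘ suc) N xs) ⟩
    eval (c 0 (suc n)) N xs + antidiagonal n (λ i j → eval (c (suc i) j) N xs) ∎
    where
    as = monomials N (length xs)
    rest : Exponents → Carrier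
    rest a = antidiagonal n (λ i j → c (suc i) j a)

  eval-convolution : ∀ c d N xs →
    eval (convolution c d) N xs ≈ antidiagonal N (λ m l → eval c m xs * eval d l xs)
  eval-convolution c d zero    [] =
    solve 2 (λ u v → (u :* v :+ con 0) :* con 1 :+ con 0 :=
                     (u :* con 1 :+ con 0) :* (v :* con 1 :+ con 0)) refl (c []) (d [])
  eval-convolution c d (suc N) [] = sym (antidiagonal-zero (suc N) vanish)
    where
    vanish : ∀ m l → m ℕ.+ l ≡ suc N → eval c m [] * eval d l [] ≈ 0#
    vanish zero    l ≡.refl = zeroʳ _
    vanish (suc m) l _      = zeroˡ _
  eval-convolution c d N (x ∷ xs) = begin
    eval (convolution c d) N (x ∷ xs)
      ≈⟨ eval-∷ (convolution c d) N x xs ⟩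
    antidiagonal N (λ n p → x ^ n * eval (convolution c d ∘ (n ∷_)) p xs)
      ≈⟨ antidiagonal-cong N (λ n p _ → expand n p) ⟩
    antidiagonal N (λ n p → antidiagonal n (λ i j → antidiagonal p (λ m l → term i j m l)))
      ≈⟨ antidiagonal-assoc N (λ i j p → antidiagonal p (term i j)) ⟩
    antidiagonal N (λ i u → antidiagonal u (λ j p → antidiagonal p (term i j)))
      ≈⟨ antidiagonal-cong N (λ i u _ → antidiagonal-exchange u (term i)) ⟩
    antidiagonal N (λ i u → antidiagonal u (λ m t → antidiagonal t (λ j l → term i j m l)))
      ≈⟨ antidiagonal-assoc N (λ i m t → antidiagonal t (λ j l → term i j m l)) ⟨
    antidiagonal N (λ s t → antidiagonal s (λ i m → antidiagonal t (λ j l → term i j m l)))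
      ≈⟨ antidiagonal-cong N (λ s t _ → collect s t) ⟩
    antidiagonal N (λ s t → eval c s (x ∷ xs) * eval d t (x ∷ xs)) ∎
    where
    γ δ : ℕ → ℕ → Carrier
    γ i m = eval (c ∘ (i ∷_)) m xs
    δ j l = eval (d ∘ (j ∷_)) l xs
    term : ℕ → ℕ → ℕ → ℕ → Carrier
    term i j m l = (x ^ i * γ i m) * (x ^ j * δ j l)
    powers : ∀ i j m l → x ^ (i ℕ.+ j) * (γ i m * δ j l) ≈ term i j m l
    powers i j m l = trans (*-congʳ (^-homo-* x i j))
      (solve 4 (λ a b u v → a :* b :* (u :* v) := (a :* u) :* (b :* v)) refl (x ^ i) (x ^ j) (γ i m) (δ j l))
    expand : ∀ n p → x ^ n * eval (convolution c d ∘ (n ∷_)) p xs ≈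
      antidiagonal n (λ i j → antidiagonal p (term i j))
    expand n p = begin
      x ^ n * eval (convolution c d ∘ (n ∷_)) p xs
        ≈⟨ *-congˡ (eval-cong p xs (λ a _ → convolution-∷ c d n a)) ⟩
      x ^ n * eval (λ a → antidiagonal n (λ i j → convolution (c ∘ (i ∷_)) (d ∘ (j ∷_)) a)) p xs
        ≈⟨ *-congˡ (eval-antidiagonal n (λ i j → convolution (c ∘ (i ∷_)) (d ∘ (j ∷_))) p xs) ⟩
      x ^ n * antidiagonal n (λ i j → eval (convolution (c ∘ (i ∷_)) (d ∘ (j ∷_))) p xs)
        ≈⟨ antidiagonal-*ˡ n (x ^ n) _ ⟨
      antidiagonal n (λ i j → x ^ n * eval (convolution (c ∘ (i ∷_)) (d ∘ (j ∷_))) p xs)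
        ≈⟨ antidiagonal-cong n (λ { i j ≡.refl → begin
             x ^ (i ℕ.+ j) * eval (convolution (c ∘ (i ∷_)) (d ∘ (j ∷_))) p xs
               ≈⟨ *-congˡ (eval-convolution (c ∘ (i ∷_)) (d ∘ (j ∷_)) p xs) ⟩
             x ^ (i ℕ.+ j) * antidiagonal p (λ m l → γ i m * δ j l)
               ≈⟨ antidiagonal-*ˡ p (x ^ (i ℕ.+ j)) _ ⟨
             antidiagonal p (λ m l → x ^ (i ℕ.+ j) * (γ i m * δ j l))
               ≈⟨ antidiagonal-cong p (λ m l _ → powers i j m l) ⟩
             antidiagonal p (term i j) ∎ }) ⟩
      antidiagonal n (λ i j → antidiagonal p (term i j)) ∎
    collect : ∀ s t → antidiagonal s (λ i m → antidiagonal t (λ j l → term i j m l)) ≈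
      eval c s (x ∷ xs) * eval d t (x ∷ xs)
    collect s t = begin
      antidiagonal s (λ i m → antidiagonal t (λ j l → term i j m l))
        ≈⟨ antidiagonal-cong s (λ i m _ → antidiagonal-*ˡ t (x ^ i * γ i m) (λ j l → x ^ j * δ j l)) ⟩
      antidiagonal s (λ i m → (x ^ i * γ i m) * antidiagonal t (λ j l → x ^ j * δ j l))
        ≈⟨ antidiagonal-*ʳ s (antidiagonal t (λ j l → x ^ j * δ j l)) (λ i m → x ^ i * γ i m) ⟩
      antidiagonal s (λ i m → x ^ i * γ i m) * antidiagonal t (λ j l → x ^ j * δ j l)
        ≈⟨ *-cong (eval-∷ c s x xs) (eval-∷ d t x xs) ⟨
      eval c s (x ∷ xs) * eval d t (x ∷ xs) ∎

  complete : ℕ → List Carrier → Carrier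
  complete = eval (λ _ → 1#)

  complete-zero : ∀ xs → complete 0 xs ≈ 1#
  complete-zero []       = solve 0 (con 1 :* con 1 :+ con 0 := con 1) refl
  complete-zero (x ∷ xs) =
    trans (eval-∷ _ 0 x xs) (trans (*-identityˡ _) (complete-zero xs))

  complete-suc-∷ : ∀ r x xs →
    complete (suc r) (x ∷ xs) ≈ complete (suc r) xs + x * complete r (x ∷ xs)
  complete-suc-∷ r x xs = begin
    complete (suc r) (x ∷ xs)
      ≈⟨ eval-∷ _ (suc r) x xs ⟩
    1# * complete (suc r) xs + antidiagonal r (λ i j → x * x ^ i * complete j xs)
      ≈⟨ +-cong (*-identityˡ _) (antidiagonal-cong r (λ i j _ → *-assoc x (x ^ i) (complete j xs))) ⟩
    complete (suc r) xs + antidiagonal r (λ i j → x * (x ^ i * complete j xs))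
      ≈⟨ +-congˡ (antidiagonal-*ˡ r x _) ⟩
    complete (suc r) xs + x * antidiagonal r (λ i j → x ^ i * complete j xs)
      ≈⟨ +-congˡ (*-congˡ (eval-∷ _ r x xs)) ⟨
    complete (suc r) xs + x * complete r (x ∷ xs) ∎

  eval-complete-* : ∀ r N c d xs →
    (∀ a → sum a ≡ r → c a ≈ 1#) → (∀ a → sum a ≢ r → c a ≈ 0#) →
    eval (convolution c d) (r ℕ.+ N) xs ≈ complete r xs * eval d N xs
  eval-complete-* r N c d xs c≈1 c≈0 = begin
    eval (convolution c d) (r ℕ.+ N) xs
      ≈⟨ eval-convolution c d (r ℕ.+ N) xs ⟩
    antidiagonal (r ℕ.+ N) (λ m l → eval c m xs * eval d l xs)
      ≈⟨ antidiagonal-single r N _ (λ m l m≢r → trans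
           (*-congʳ (eval-zero m xs (λ a a≡m → c≈0 a (λ a≡r → m≢r (≡.trans (≡.sym a≡m) a≡r)))))
           (zeroˡ _)) ⟩
    eval c r xs * eval d N xs
      ≈⟨ *-congʳ (eval-cong r xs c≈1) ⟩
    complete r xs * eval d N xs ∎

  module _ (q : Carrier) where

    -- The Gaussian binomial coefficient [n+r-1 choose r].
    gaussian : ℕ → ℕ → Carrier
    gaussian r n = complete r (map (q ^_) (downFrom n))

    gaussian-zero : ∀ n → gaussian 0 n ≈ 1#
    gaussian-zero n = complete-zero (map (q ^_) (downFrom n))

    gaussian-suc : ∀ r n →
      gaussian (suc r) (suc n) ≈ gaussian (suc r) n + q ^ n * gaussian r (suc n)
    gaussian-suc r n = complete-suc-∷ r (q ^ n) (map (q ^_) (downFrom n))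

    gaussian-pascal : ∀ r n →
      gaussian (suc r) (suc n) ≈ gaussian r (suc n) + q ^ suc r * gaussian (suc r) n
    gaussian-pascal r zero = begin
      gaussian (suc r) 1                          ≈⟨ gaussian-suc r 0 ⟩
      0# + 1# * gaussian r 1                      ≈⟨ solve 2 (λ g u → con 0 :+ con 1 :* g := g :+ u :* con 0) refl (gaussian r 1) (q ^ suc r) ⟩
      gaussian r 1 + q ^ suc r * 0#               ∎
    gaussian-pascal zero (suc n) = begin
      gaussian 1 (suc (suc n))
        ≈⟨ gaussian-suc 0 (suc n) ⟩
      gaussian 1 (suc n) + q ^ suc n * gaussian 0 (suc (suc n))
        ≈⟨ +-cong (gaussian-pascal 0 n) (*-congˡ (gaussian-zero (suc (suc n)))) ⟩
      (gaussian 0 (suc n) + q * 1# * gaussian 1 n) + q ^ suc n * 1#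
        ≈⟨ +-congʳ (+-congʳ (gaussian-zero (suc n))) ⟩
      (1# + q * 1# * gaussian 1 n) + q * q ^ n * 1#
        ≈⟨ solve 3 (λ a x u → (con 1 :+ x :* con 1 :* a) :+ x :* u :* con 1 :=
                              con 1 :+ x :* con 1 :* (a :+ u :* con 1)) refl (gaussian 1 n) q (q ^ n) ⟩
      1# + q * 1# * (gaussian 1 n + q ^ n * 1#)
        ≈⟨ +-cong (gaussian-zero (suc (suc n))) (*-congˡ (+-congˡ (*-congˡ (gaussian-zero (suc n))))) ⟨
      gaussian 0 (suc (suc n)) + q * 1# * (gaussian 1 n + q ^ n * gaussian 0 (suc n))
        ≈⟨ +-congˡ (*-congˡ (gaussian-suc 0 n)) ⟨
      gaussian 0 (suc (suc n)) + q * 1# * gaussian 1 (suc n) ∎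
    gaussian-pascal (suc r) (suc n) = begin
      gaussian (suc (suc r)) (suc (suc n))
        ≈⟨ gaussian-suc (suc r) (suc n) ⟩
      gaussian (suc (suc r)) (suc n) + q ^ suc n * C
        ≈⟨ +-cong (gaussian-pascal (suc r) n) (*-congˡ (gaussian-pascal r (suc n))) ⟩
      (B + q ^ suc (suc r) * A) + q ^ suc n * (C′ + q ^ suc r * B)
        ≈⟨ solve 6 (λ a b c′ x u v →
             (b :+ x :* v :* a) :+ x :* u :* (c′ :+ v :* b) :=
             (b :+ x :* u :* c′) :+ x :* v :* (a :+ u :* b)) refl A B C′ q (q ^ n) (q ^ suc r) ⟩
      (B + q ^ suc n * C′) + q ^ suc (suc r) * (A + q ^ n * B)
        ≈⟨ +-cong (gaussian-suc r (suc n)) (*-congˡ (gaussian-suc (suc r) n)) ⟨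
      C + q ^ suc (suc r) * gaussian (suc (suc r)) (suc n) ∎
      where
      A  = gaussian (suc (suc r)) n
      B  = gaussian (suc r) (suc n)
      C  = gaussian (suc r) (suc (suc n))
      C′ = gaussian r (suc (suc n))

    -- (1 - q^{r+1}) [n+r+1 choose r+1] = (1 - q^{n+r+1}) [n+r choose r], with
    -- both sides moved so that no subtraction occurs.
    gaussian-ratio : ∀ r n →
      gaussian (suc r) (suc n) + q ^ suc r * (q ^ n * gaussian r (suc n)) ≈
      gaussian r (suc n) + q ^ suc r * gaussian (suc r) (suc n)
    gaussian-ratio r n = begin
      gaussian (suc r) (suc n) + q ^ suc r * (q ^ n * B)  ≈⟨ +-congʳ (gaussian-pascal r n) ⟩
      B + q ^ suc r * A + q ^ suc r * (q ^ n * B)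
        ≈⟨ solve 4 (λ a b u v → b :+ v :* a :+ v :* (u :* b) := b :+ v :* (a :+ u :* b)) refl A B (q ^ n) (q ^ suc r) ⟩
      B + q ^ suc r * (A + q ^ n * B)                     ≈⟨ +-congˡ (*-congˡ (gaussian-suc r n)) ⟨
      B + q ^ suc r * gaussian (suc r) (suc n)            ∎
      where
      A = gaussian (suc r) n
      B = gaussian r (suc n)

module Scaling {c ℓ} (R : CommutativeRing c ℓ) where

  open CommutativeRing R
  open import Algebra.Properties.Ring ring using (-‿distribˡ-*; -‿distribʳ-*)
  open import Relation.Binary.Reasoning.Setoid setoid
  open import Algebra.Solver.Ring.NaturalCoefficients.Default commutativeSemiring

  transpose : ∀ w x y z → x + w ≈ z + y → x - y ≈ z - w
  transpose w x y z x+w≈z+y = begin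
    x - y                    ≈⟨ +-identityʳ (x - y) ⟨
    (x - y) + 0#             ≈⟨ +-congˡ (-‿inverseʳ w) ⟨
    (x - y) + (w - w)        ≈⟨ solve 4 (λ a b c d → (a :+ b) :+ (c :+ d) := (a :+ c) :+ (b :+ d)) refl x (- y) w (- w) ⟩
    (x + w) + (- y + - w)    ≈⟨ +-congʳ x+w≈z+y ⟩
    (z + y) + (- y + - w)    ≈⟨ solve 4 (λ a b c d → (a :+ b) :+ (c :+ d) := (a :+ d) :+ (b :+ c)) refl z y (- y) (- w) ⟩
    (z - w) + (y - y)        ≈⟨ +-congˡ (-‿inverseʳ y) ⟩
    (z - w) + 0#             ≈⟨ +-identityʳ (z - w) ⟩
    z - w                    ∎

  -- With a = q^{r+1} and u = q^k, the term v * (F - a * (u * F)) is the k-th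
  -- coefficient of factor r F.
  rescale : ∀ a u v F X Y → v * (1# - a) ≈ 1# → X + a * (u * Y) ≈ Y + a * X →
    Y * (v * (F - a * (u * F))) ≈ X * F
  rescale a u v F X Y v-inverse ratio = begin
    Y * (v * (F - a * (u * F)))
      ≈⟨ solve 4 (λ y v f g → y :* (v :* (f :+ g)) := v :* (y :* f :+ y :* g)) refl Y v F (- (a * (u * F))) ⟩
    v * (Y * F + Y * - (a * (u * F)))
      ≈⟨ *-congˡ (+-congˡ (-‿distribʳ-* Y (a * (u * F)))) ⟨
    v * (Y * F - Y * (a * (u * F)))
      ≈⟨ *-congˡ (transpose (a * (X * F)) (Y * F) (Y * (a * (u * F))) (X * F) times-F) ⟩
    v * (X * F - a * (X * F))
      ≈⟨ *-congˡ (+-congˡ (-‿distribˡ-* a (X * F))) ⟩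
    v * (X * F + - a * (X * F))
      ≈⟨ solve 3 (λ v b g → v :* (g :+ b :* g) := v :* (con 1 :+ b) :* g) refl v (- a) (X * F) ⟩
    v * (1# - a) * (X * F)
      ≈⟨ *-congʳ v-inverse ⟩
    1# * (X * F)
      ≈⟨ *-identityˡ (X * F) ⟩
    X * F ∎
    where
    times-F : Y * F + a * (X * F) ≈ X * F + Y * (a * (u * F))
    times-F = begin
      Y * F + a * (X * F)          ≈⟨ solve 4 (λ y f a x → y :* f :+ a :* (x :* f) := (y :+ a :* x) :* f) refl Y F a X ⟩
      (Y + a * X) * F              ≈⟨ *-congʳ ratio ⟨
      (X + a * (u * Y)) * F        ≈⟨ solve 5 (λ y f a x u → (x :+ a :* (u :* y)) :* f := x :* f :+ y :* (a :* (u :* f))) refl Y F a X u ⟩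
      X * F + Y * (a * (u * F))    ∎

module CrossMultiplication {c ℓ} (R : CommutativeSemiring c ℓ) where

  open CommutativeSemiring R
  open import Relation.Binary.Reasoning.Setoid setoid
  open import Algebra.Solver.Ring.NaturalCoefficients.Default R

  chain : ∀ a b c d e f → a * d ≈ c * b → c * f ≈ e * d → a * f * d ≈ e * b * d
  chain a b c d e f ad≈cb cf≈ed = begin
    a * f * d    ≈⟨ solve 3 (λ a f d → a :* f :* d := a :* d :* f) refl a f d ⟩
    a * d * f    ≈⟨ *-congʳ ad≈cb ⟩
    c * b * f    ≈⟨ solve 3 (λ c b f → c :* b :* f := c :* f :* b) refl c b f ⟩
    c * f * b    ≈⟨ *-congʳ cf≈ed ⟩
    e * d * b    ≈⟨ solve 3 (λ e d b → e :* d :* b := e :* b :* d) refl e d b ⟩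
    e * b * d    ∎

  sum-cong : ∀ a b a′ b′ c d c′ d′ → a * b′ ≈ a′ * b → c * d′ ≈ c′ * d →
    (a * d + c * b) * (b′ * d′) ≈ (a′ * d′ + c′ * b′) * (b * d)
  sum-cong a b a′ b′ c d c′ d′ ab′≈a′b cd′≈c′d = begin
    (a * d + c * b) * (b′ * d′)
      ≈⟨ solve 6 (λ a b b′ c d d′ → (a :* d :+ c :* b) :* (b′ :* d′) :=
                    a :* b′ :* (d :* d′) :+ c :* d′ :* (b :* b′)) refl a b b′ c d d′ ⟩
    a * b′ * (d * d′) + c * d′ * (b * b′)
      ≈⟨ +-cong (*-congʳ ab′≈a′b) (*-congʳ cd′≈c′d) ⟩
    a′ * b * (d * d′) + c′ * d * (b * b′)
      ≈⟨ solve 6 (λ a′ b b′ c′ d d′ → a′ :* b :* (d :* d′) :+ c′ :* d :* (b :* b′) :=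
                    (a′ :* d′ :+ c′ :* b′) :* (b :* d)) refl a′ b b′ c′ d d′ ⟩
    (a′ * d′ + c′ * b′) * (b * d) ∎

  product-cong : ∀ a b a′ b′ c d c′ d′ → a * b′ ≈ a′ * b → c * d′ ≈ c′ * d →
    (a * c) * (b′ * d′) ≈ (a′ * c′) * (b * d)
  product-cong a b a′ b′ c d c′ d′ ab′≈a′b cd′≈c′d = begin
    (a * c) * (b′ * d′)  ≈⟨ interchange a c b′ d′ ⟩
    (a * b′) * (c * d′)  ≈⟨ *-cong ab′≈a′b cd′≈c′d ⟩
    (a′ * b) * (c′ * d)  ≈⟨ interchange a′ b c′ d ⟩
    (a′ * c′) * (b * d)  ∎
    where
    interchange : ∀ w x y z → (w * x) * (y * z) ≈ (w * y) * (x * z)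
    interchange = solve 4 (λ w x y z → (w :* x) :* (y :* z) := (w :* y) :* (x :* z)) refl

open import Defs

open Antidiagonal (CommutativeRing.commutativeSemiring ℚ.+-*-commutativeRing)

coeffₚ-* : ∀ p r n →
  coeffₚ (p *ₚ r) n ≡ antidiagonal n (λ i j → coeffₚ p i ℚ.* coeffₚ r j)
coeffₚ-* []      r n       = ≡.sym (antidiagonal-zero n (λ i j _ → ℚ.*-zeroˡ (coeffₚ r j)))
coeffₚ-* (a ∷ p) r zero    = coeffₚ-*-zero (a ∷ p) r
coeffₚ-* (a ∷ p) r (suc n) =
  ≡.trans (coeffₚ-∷-* a p r (suc n)) (≡.cong (a ℚ.* coeffₚ r (suc n) ℚ.+_) (coeffₚ-* p r n))

coeffₚ-neg : ∀ p n → coeffₚ (-ₚ p) n ≡ ℚ.- coeffₚ p n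
coeffₚ-neg []      n       = ≡.refl
coeffₚ-neg (a ∷ p) zero    = ≡.refl
coeffₚ-neg (a ∷ p) (suc n) = coeffₚ-neg p n

coeffₚ-0 : ∀ n → coeffₚ (0ℚ ∷ []) n ≡ 0ℚ
coeffₚ-0 zero    = ≡.refl
coeffₚ-0 (suc n) = ≡.refl

+ₚ-cong : ∀ {p p′ r r′} → p ≈ₚ p′ → r ≈ₚ r′ → p +ₚ r ≈ₚ p′ +ₚ r′
+ₚ-cong {p} {p′} {r} {r′} p≈p′ r≈r′ n = begin
  coeffₚ (p +ₚ r) n              ≡⟨ coeffₚ-+ p r n ⟩
  coeffₚ p n ℚ.+ coeffₚ r n      ≡⟨ ≡.cong₂ ℚ._+_ (p≈p′ n) (r≈r′ n) ⟩
  coeffₚ p′ n ℚ.+ coeffₚ r′ n    ≡⟨ coeffₚ-+ p′ r′ n ⟨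
  coeffₚ (p′ +ₚ r′) n            ∎
  where open ≡-Reasoning

+ₚ-assoc : ∀ p r s → (p +ₚ r) +ₚ s ≈ₚ p +ₚ (r +ₚ s)
+ₚ-assoc p r s n = begin
  coeffₚ ((p +ₚ r) +ₚ s) n                       ≡⟨ coeffₚ-+ (p +ₚ r) s n ⟩
  coeffₚ (p +ₚ r) n ℚ.+ coeffₚ s n               ≡⟨ ≡.cong (ℚ._+ coeffₚ s n) (coeffₚ-+ p r n) ⟩
  coeffₚ p n ℚ.+ coeffₚ r n ℚ.+ coeffₚ s n       ≡⟨ ℚ.+-assoc (coeffₚ p n) (coeffₚ r n) (coeffₚ s n) ⟩
  coeffₚ p n ℚ.+ (coeffₚ r n ℚ.+ coeffₚ s n)     ≡⟨ ≡.cong (coeffₚ p n ℚ.+_) (coeffₚ-+ r s n) ⟨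
  coeffₚ p n ℚ.+ coeffₚ (r +ₚ s) n               ≡⟨ coeffₚ-+ p (r +ₚ s) n ⟨
  coeffₚ (p +ₚ (r +ₚ s)) n                       ∎
  where open ≡-Reasoning

+ₚ-comm : ∀ p r → p +ₚ r ≈ₚ r +ₚ p
+ₚ-comm p r n = begin
  coeffₚ (p +ₚ r) n            ≡⟨ coeffₚ-+ p r n ⟩
  coeffₚ p n ℚ.+ coeffₚ r n    ≡⟨ ℚ.+-comm (coeffₚ p n) (coeffₚ r n) ⟩
  coeffₚ r n ℚ.+ coeffₚ p n    ≡⟨ coeffₚ-+ r p n ⟨
  coeffₚ (r +ₚ p) n            ∎
  where open ≡-Reasoning

+ₚ-identityˡ : ∀ p → (0ℚ ∷ []) +ₚ p ≈ₚ p
+ₚ-identityˡ p n = begin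
  coeffₚ ((0ℚ ∷ []) +ₚ p) n             ≡⟨ coeffₚ-+ (0ℚ ∷ []) p n ⟩
  coeffₚ (0ℚ ∷ []) n ℚ.+ coeffₚ p n     ≡⟨ ≡.cong (ℚ._+ coeffₚ p n) (coeffₚ-0 n) ⟩
  0ℚ ℚ.+ coeffₚ p n                     ≡⟨ ℚ.+-identityˡ (coeffₚ p n) ⟩
  coeffₚ p n                            ∎
  where open ≡-Reasoning

-ₚ-inverseˡ : ∀ p → (-ₚ p) +ₚ p ≈ₚ 0ℚ ∷ []
-ₚ-inverseˡ p n = begin
  coeffₚ ((-ₚ p) +ₚ p) n              ≡⟨ coeffₚ-+ (-ₚ p) p n ⟩
  coeffₚ (-ₚ p) n ℚ.+ coeffₚ p n      ≡⟨ ≡.cong (ℚ._+ coeffₚ p n) (coeffₚ-neg p n) ⟩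
  ℚ.- coeffₚ p n ℚ.+ coeffₚ p n       ≡⟨ ℚ.+-inverseˡ (coeffₚ p n) ⟩
  0ℚ                                  ≡⟨ coeffₚ-0 n ⟨
  coeffₚ (0ℚ ∷ []) n                  ∎
  where open ≡-Reasoning

-ₚ-cong : ∀ {p p′} → p ≈ₚ p′ → -ₚ p ≈ₚ -ₚ p′
-ₚ-cong {p} {p′} p≈p′ n =
  ≡.trans (coeffₚ-neg p n) (≡.trans (≡.cong ℚ.-_ (p≈p′ n)) (≡.sym (coeffₚ-neg p′ n)))

*ₚ-cong : ∀ {p p′ r r′} → p ≈ₚ p′ → r ≈ₚ r′ → p *ₚ r ≈ₚ p′ *ₚ r′
*ₚ-cong {p} {p′} {r} {r′} p≈p′ r≈r′ n = begin
  coeffₚ (p *ₚ r) n                                        ≡⟨ coeffₚ-* p r n ⟩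
  antidiagonal n (λ i j → coeffₚ p i ℚ.* coeffₚ r j)
    ≡⟨ antidiagonal-cong n (λ i j _ → ≡.cong₂ ℚ._*_ (p≈p′ i) (r≈r′ j)) ⟩
  antidiagonal n (λ i j → coeffₚ p′ i ℚ.* coeffₚ r′ j)     ≡⟨ coeffₚ-* p′ r′ n ⟨
  coeffₚ (p′ *ₚ r′) n                                      ∎
  where open ≡-Reasoning

*ₚ-comm : ∀ p r → p *ₚ r ≈ₚ r *ₚ p
*ₚ-comm p r n = begin
  coeffₚ (p *ₚ r) n                                      ≡⟨ coeffₚ-* p r n ⟩
  antidiagonal n (λ i j → coeffₚ p i ℚ.* coeffₚ r j)     ≡⟨ antidiagonal-comm n _ ⟩
  antidiagonal n (λ j i → coeffₚ p i ℚ.* coeffₚ r j)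
    ≡⟨ antidiagonal-cong n (λ j i _ → ℚ.*-comm (coeffₚ p i) (coeffₚ r j)) ⟩
  antidiagonal n (λ j i → coeffₚ r j ℚ.* coeffₚ p i)     ≡⟨ coeffₚ-* r p n ⟨
  coeffₚ (r *ₚ p) n                                      ∎
  where open ≡-Reasoning

*ₚ-assoc : ∀ p r s → (p *ₚ r) *ₚ s ≈ₚ p *ₚ (r *ₚ s)
*ₚ-assoc p r s n = begin
  coeffₚ ((p *ₚ r) *ₚ s) n
    ≡⟨ coeffₚ-* (p *ₚ r) s n ⟩
  antidiagonal n (λ m l → coeffₚ (p *ₚ r) m ℚ.* coeffₚ s l)
    ≡⟨ antidiagonal-cong n (λ m l _ → ≡.trans
         (≡.cong (ℚ._* coeffₚ s l) (coeffₚ-* p r m))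
         (≡.sym (antidiagonal-*ʳ m (coeffₚ s l) _))) ⟩
  antidiagonal n (λ m l → antidiagonal m (λ i j → coeffₚ p i ℚ.* coeffₚ r j ℚ.* coeffₚ s l))
    ≡⟨ antidiagonal-assoc n (λ i j l → coeffₚ p i ℚ.* coeffₚ r j ℚ.* coeffₚ s l) ⟩
  antidiagonal n (λ i m → antidiagonal m (λ j l → coeffₚ p i ℚ.* coeffₚ r j ℚ.* coeffₚ s l))
    ≡⟨ antidiagonal-cong n (λ i m _ → ≡.trans
         (antidiagonal-cong m (λ j l _ → ℚ.*-assoc (coeffₚ p i) (coeffₚ r j) (coeffₚ s l)))
         (≡.trans (antidiagonal-*ˡ m (coeffₚ p i) _)
                  (≡.cong (coeffₚ p i ℚ.*_) (≡.sym (coeffₚ-* r s m))))) ⟩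
  antidiagonal n (λ i m → coeffₚ p i ℚ.* coeffₚ (r *ₚ s) m)
    ≡⟨ coeffₚ-* p (r *ₚ s) n ⟨
  coeffₚ (p *ₚ (r *ₚ s)) n ∎
  where open ≡-Reasoning

*ₚ-identityˡ : ∀ p → (1ℚ ∷ []) *ₚ p ≈ₚ p
*ₚ-identityˡ p n = begin
  coeffₚ ((1ℚ ∷ []) *ₚ p) n                      ≡⟨ coeffₚ-∷-* 1ℚ [] p n ⟩
  1ℚ ℚ.* coeffₚ p n ℚ.+ coeffₚ (0ℚ ∷ []) n       ≡⟨ ≡.cong₂ ℚ._+_ (ℚ.*-identityˡ (coeffₚ p n)) (coeffₚ-0 n) ⟩
  coeffₚ p n ℚ.+ 0ℚ                              ≡⟨ ℚ.+-identityʳ (coeffₚ p n) ⟩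
  coeffₚ p n                                     ∎
  where open ≡-Reasoning

*ₚ-distribˡ-+ₚ : ∀ p r s → p *ₚ (r +ₚ s) ≈ₚ p *ₚ r +ₚ p *ₚ s
*ₚ-distribˡ-+ₚ p r s n = begin
  coeffₚ (p *ₚ (r +ₚ s)) n
    ≡⟨ coeffₚ-* p (r +ₚ s) n ⟩
  antidiagonal n (λ i j → coeffₚ p i ℚ.* coeffₚ (r +ₚ s) j)
    ≡⟨ antidiagonal-cong n (λ i j _ → ≡.trans
         (≡.cong (coeffₚ p i ℚ.*_) (coeffₚ-+ r s j))
         (ℚ.*-distribˡ-+ (coeffₚ p i) (coeffₚ r j) (coeffₚ s j))) ⟩
  antidiagonal n (λ i j → coeffₚ p i ℚ.* coeffₚ r j ℚ.+ coeffₚ p i ℚ.* coeffₚ s j)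
    ≡⟨ antidiagonal-+ n _ _ ⟩
  antidiagonal n (λ i j → coeffₚ p i ℚ.* coeffₚ r j) ℚ.+
    antidiagonal n (λ i j → coeffₚ p i ℚ.* coeffₚ s j)
    ≡⟨ ≡.cong₂ ℚ._+_ (coeffₚ-* p r n) (coeffₚ-* p s n) ⟨
  coeffₚ (p *ₚ r) n ℚ.+ coeffₚ (p *ₚ s) n
    ≡⟨ coeffₚ-+ (p *ₚ r) (p *ₚ s) n ⟨
  coeffₚ (p *ₚ r +ₚ p *ₚ s) n ∎
  where open ≡-Reasoning

≈ₚ-setoid : Setoid 0ℓ 0ℓ
≈ₚ-setoid = record
  { Carrier       = Poly
  ; _≈_           = _≈ₚ_
  ; isEquivalence = record
    { refl  = λ _ → ≡.refl
    ; sym   = λ p≈r n → ≡.sym (p≈r n)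
    ; trans = λ p≈r r≈s n → ≡.trans (p≈r n) (r≈s n)
    }
  }

polynomialRing : CommutativeRing 0ℓ 0ℓ
polynomialRing = record
  { Carrier = Poly ; _≈_ = _≈ₚ_ ; _+_ = _+ₚ_ ; _*_ = _*ₚ_ ; -_ = -ₚ_
  ; 0# = 0ℚ ∷ [] ; 1# = 1ℚ ∷ []
  ; isCommutativeRing = record
    { isRing = record
      { +-isAbelianGroup = record
        { isGroup = record
          { isMonoid = record
            { isSemigroup = record
              { isMagma = record
                { isEquivalence = Setoid.isEquivalence ≈ₚ-setoid
                ; ∙-cong        = λ {p} {p′} {r} {r′} → +ₚ-cong {p} {p′} {r} {r′}
                }
              ; assoc = +ₚ-assoc
              }
            ; identity = comm∧idˡ⇒id ≈ₚ-setoid {_+ₚ_} +ₚ-comm {0ℚ ∷ []} +ₚ-identityˡ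
            }
          ; inverse = comm∧invˡ⇒inv ≈ₚ-setoid {_+ₚ_} { -ₚ_} {0ℚ ∷ []} +ₚ-comm -ₚ-inverseˡ
          ; ⁻¹-cong = λ {p} {p′} → -ₚ-cong {p} {p′}
          }
        ; comm = +ₚ-comm
        }
      ; *-cong     = λ {p} {p′} {r} {r′} → *ₚ-cong {p} {p′} {r} {r′}
      ; *-assoc    = *ₚ-assoc
      ; *-identity = comm∧idˡ⇒id ≈ₚ-setoid {_*ₚ_} *ₚ-comm {1ℚ ∷ []} *ₚ-identityˡ
      ; distrib    = comm∧distrˡ⇒distr ≈ₚ-setoid {_*ₚ_} {_+ₚ_}
          (λ {p} {p′} {r} {r′} → +ₚ-cong {p} {p′} {r} {r′}) *ₚ-comm *ₚ-distribˡ-+ₚ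
      }
    ; *-comm = *ₚ-comm
    }
  }

module ℚ[q] = CommutativeRing polynomialRing
module Cross = CrossMultiplication ℚ[q].commutativeSemiring
open import Algebra.Solver.Ring.NaturalCoefficients.Default ℚ[q].commutativeSemiring
  using (solve; _:=_; _:+_; _:*_; con)

*ₚ-cancelʳ : ∀ d p r → NonZeroₚ d → p *ₚ d ≈ₚ r *ₚ d → p ≈ₚ r
*ₚ-cancelʳ d p r d≢0 pd≈rd n with coeffₚ (p ℚ[q].- r) n ℚ.≟ 0ℚ
... | yes difference≡0 = x∙y⁻¹≈ε⇒x≈y (coeffₚ p n) (coeffₚ r n) (begin
  coeffₚ p n ℚ.- coeffₚ r n           ≡⟨ ≡.cong (coeffₚ p n ℚ.+_) (coeffₚ-neg r n) ⟨
  coeffₚ p n ℚ.+ coeffₚ (-ₚ r) n      ≡⟨ coeffₚ-+ p (-ₚ r) n ⟨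
  coeffₚ (p ℚ[q].- r) n               ≡⟨ difference≡0 ⟩
  0ℚ                                  ∎)
  where
  open ≡-Reasoning
  open import Algebra.Properties.Group ℚ.+-0-group using (x∙y⁻¹≈ε⇒x≈y)
... | no difference≢0 with *ₚ-nonZero (p ℚ[q].- r) d (n , difference≢0) d≢0
...   | m , product≢0 = contradiction (≡.trans (product≈0 m) (coeffₚ-0 m)) product≢0
  where
  open import Relation.Binary.Reasoning.Setoid ℚ[q].setoid
  open import Algebra.Properties.Ring ℚ[q].ring using (-‿distribˡ-*)
  product≈0 : (p ℚ[q].- r) *ₚ d ≈ₚ 0ℚ ∷ []
  product≈0 = begin
    (p ℚ[q].- r) *ₚ d            ≈⟨ ℚ[q].distribʳ d p (-ₚ r) ⟩
    p *ₚ d +ₚ (-ₚ r) *ₚ d        ≈⟨ +ₚ-cong {p *ₚ d} {r *ₚ d} {(-ₚ r) *ₚ d} { -ₚ (r *ₚ d)} pd≈rd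
                                    (ℚ[q].sym { -ₚ (r *ₚ d)} {(-ₚ r) *ₚ d} (-‿distribˡ-* r d)) ⟩
    r *ₚ d +ₚ (-ₚ (r *ₚ d))      ≈⟨ ℚ[q].-‿inverseʳ (r *ₚ d) ⟩
    0ℚ ∷ []                      ∎

≈-setoid : Setoid 0ℓ 0ℓ
≈-setoid = record
  { Carrier       = ℚ⟨q⟩
  ; _≈_           = _≈_
  ; isEquivalence = record
    { refl  = λ _ → ≡.refl
    ; sym   = λ x≈y n → ≡.sym (x≈y n)
    ; trans = λ {x} {y} {z} x≈y y≈z →
        *ₚ-cancelʳ (den y) (num x *ₚ den z) (num z *ₚ den x) (den≢0 y)
          (Cross.chain (num x) (den x) (num y) (den y) (num z) (den z) x≈y y≈z)
    }
  }

+-cong : ∀ {x x′ y y′} → x ≈ x′ → y ≈ y′ → x + y ≈ x′ + y′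
+-cong {x} {x′} {y} {y′} = Cross.sum-cong
  (num x) (den x) (num x′) (den x′) (num y) (den y) (num y′) (den y′)

*-cong : ∀ {x x′ y y′} → x ≈ x′ → y ≈ y′ → x * y ≈ x′ * y′
*-cong {x} {x′} {y} {y′} = Cross.product-cong
  (num x) (den x) (num x′) (den x′) (num y) (den y) (num y′) (den y′)

-‿cong : ∀ {x x′} → x ≈ x′ → - x ≈ - x′
-‿cong {x} {x′} x≈x′ = begin
  (-ₚ num x) *ₚ den x′      ≈⟨ -‿distribˡ-* (num x) (den x′) ⟨
  -ₚ (num x *ₚ den x′)      ≈⟨ -ₚ-cong {num x *ₚ den x′} {num x′ *ₚ den x} x≈x′ ⟩
  -ₚ (num x′ *ₚ den x)      ≈⟨ -‿distribˡ-* (num x′) (den x) ⟩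
  (-ₚ num x′) *ₚ den x      ∎
  where
  open import Relation.Binary.Reasoning.Setoid ℚ[q].setoid
  open import Algebra.Properties.Ring ℚ[q].ring using (-‿distribˡ-*)

+-comm : ∀ x y → x + y ≈ y + x
+-comm x y = solve 4 (λ a b c d → (a :* d :+ c :* b) :* (d :* b) := (c :* b :+ a :* d) :* (b :* d))
  (λ _ → ≡.refl) (num x) (den x) (num y) (den y)

+-assoc : ∀ x y z → (x + y) + z ≈ x + (y + z)
+-assoc x y z = solve 6 (λ a b c d e f →
    ((a :* d :+ c :* b) :* f :+ e :* (b :* d)) :* (b :* (d :* f)) :=
    (a :* (d :* f) :+ (c :* f :+ e :* d) :* b) :* ((b :* d) :* f))
  (λ _ → ≡.refl) (num x) (den x) (num y) (den y) (num z) (den z)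

+-identityˡ : ∀ x → 0# + x ≈ x
+-identityˡ x = solve 2 (λ a b → (con 0 :* b :+ a :* con 1) :* b := a :* (con 1 :* b))
  (λ _ → ≡.refl) (num x) (den x)

-‿inverseˡ : ∀ x → (- x) + x ≈ 0#
-‿inverseˡ x = begin
  ((-ₚ n) *ₚ d +ₚ n *ₚ d) *ₚ (1ℚ ∷ [])
    ≈⟨ solve 3 (λ a b c → (a :* b :+ c :* b) :* con 1 := (a :+ c) :* b) (λ _ → ≡.refl) (-ₚ n) d n ⟩
  ((-ₚ n) +ₚ n) *ₚ d        ≈⟨ ℚ[q].*-congʳ {d} {(-ₚ n) +ₚ n} {0ℚ ∷ []} (-ₚ-inverseˡ n) ⟩
  (0ℚ ∷ []) *ₚ d            ≈⟨ solve 1 (λ b → con 0 :* b := con 0 :* (b :* b)) (λ _ → ≡.refl) d ⟩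
  (0ℚ ∷ []) *ₚ (d *ₚ d)     ∎
  where
  n = num x
  d = den x
  open import Relation.Binary.Reasoning.Setoid ℚ[q].setoid

*-comm : ∀ x y → x * y ≈ y * x
*-comm x y = solve 4 (λ a b c d → (a :* c) :* (d :* b) := (c :* a) :* (b :* d))
  (λ _ → ≡.refl) (num x) (den x) (num y) (den y)

*-assoc : ∀ x y z → (x * y) * z ≈ x * (y * z)
*-assoc x y z = solve 6 (λ a b c d e f →
    ((a :* c) :* e) :* (b :* (d :* f)) := (a :* (c :* e)) :* ((b :* d) :* f))
  (λ _ → ≡.refl) (num x) (den x) (num y) (den y) (num z) (den z)

*-identityˡ : ∀ x → 1# * x ≈ x
*-identityˡ x = solve 2 (λ a b → (con 1 :* a) :* b := a :* (con 1 :* b))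
  (λ _ → ≡.refl) (num x) (den x)

*-distribˡ-+ : ∀ x y z → x * (y + z) ≈ x * y + x * z
*-distribˡ-+ x y z = solve 6 (λ a b c d e f →
    (a :* (c :* f :+ e :* d)) :* ((b :* d) :* (b :* f)) :=
    ((a :* c) :* (b :* f) :+ (a :* e) :* (b :* d)) :* (b :* (d :* f)))
  (λ _ → ≡.refl) (num x) (den x) (num y) (den y) (num z) (den z)

rationalFunctionRing : CommutativeRing 0ℓ 0ℓ
rationalFunctionRing = record
  { Carrier = ℚ⟨q⟩ ; _≈_ = _≈_ ; _+_ = _+_ ; _*_ = _*_ ; -_ = -_ ; 0# = 0# ; 1# = 1#
  ; isCommutativeRing = record
    { isRing = record
      { +-isAbelianGroup = record
        { isGroup = record
          { isMonoid = record
            { isSemigroup = record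
              { isMagma = record
                { isEquivalence = Setoid.isEquivalence ≈-setoid
                ; ∙-cong        = λ {x} {x′} {y} {y′} → +-cong {x} {x′} {y} {y′}
                }
              ; assoc = +-assoc
              }
            ; identity = comm∧idˡ⇒id ≈-setoid {_+_} +-comm {0#} +-identityˡ
            }
          ; inverse = comm∧invˡ⇒inv ≈-setoid {_+_} { -_} {0#} +-comm -‿inverseˡ
          ; ⁻¹-cong = λ {x} {x′} → -‿cong {x} {x′}
          }
        ; comm = +-comm
        }
      ; *-cong     = λ {x} {x′} {y} {y′} → *-cong {x} {x′} {y} {y′}
      ; *-assoc    = *-assoc
      ; *-identity = comm∧idˡ⇒id ≈-setoid {_*_} *-comm {1#} *-identityˡ
      ; distrib    = comm∧distrˡ⇒distr ≈-setoid {_*_} {_+_}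
          (λ {x} {x′} {y} {y′} → +-cong {x} {x′} {y} {y′}) *-comm *-distribˡ-+
      }
    ; *-comm = *-comm
    }
  }

module ℚ⟨q⟩-Ring = CommutativeRing rationalFunctionRing
open Evaluation ℚ⟨q⟩-Ring.commutativeSemiring
open Scaling rationalFunctionRing using (rescale)

inverseˡ : ∀ x (x≢0 : NonZeroₚ (num x)) → inverse x x≢0 * x ≈ 1#
inverseˡ x _ = solve 2 (λ a b → (b :* a) :* con 1 := con 1 :* (a :* b))
  (λ _ → ≡.refl) (num x) (den x)

fromPoly-+ : ∀ p r → fromPoly (p +ₚ r) ≈ fromPoly p + fromPoly r
fromPoly-+ p r = solve 2 (λ a b → (a :+ b) :* (con 1 :* con 1) := (a :* con 1 :+ b :* con 1) :* con 1)
  (λ _ → ≡.refl) p r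

fromPoly-* : ∀ p r → fromPoly (p *ₚ r) ≈ fromPoly p * fromPoly r
fromPoly-* p r = solve 2 (λ a b → (a :* b) :* (con 1 :* con 1) := (a :* b) :* con 1)
  (λ _ → ≡.refl) p r

fromℚ-* : ∀ a b → fromℚ (a ℚ.* b) ≈ fromℚ a * fromℚ b
fromℚ-* a b = ≡.subst (λ c → fromℚ c ≈ fromℚ a * fromℚ b) (ℚ.+-identityʳ (a ℚ.* b))
  (fromPoly-* (a ∷ []) (b ∷ []))

fromℚ-sumOver : {A : Set} (f : A → ℚ) (g : A → ℚ⟨q⟩) (xs : List A) →
  (∀ x → fromℚ (f x) ≈ g x) → fromℚ (sumOver xs f) ≈ ∑ xs g
fromℚ-sumOver f g []       f≈g = λ _ → ≡.refl
fromℚ-sumOver f g (x ∷ xs) f≈g = begin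
  fromℚ (f x ℚ.+ sumOver xs f)            ≈⟨ fromPoly-+ (f x ∷ []) (sumOver xs f ∷ []) ⟩
  fromℚ (f x) + fromℚ (sumOver xs f)      ≈⟨ +-cong {fromℚ (f x)} {g x} {fromℚ (sumOver xs f)} {∑ xs g}
                                               (f≈g x) (fromℚ-sumOver f g xs f≈g) ⟩
  g x + ∑ xs g                            ∎
  where open import Relation.Binary.Reasoning.Setoid ≈-setoid

Ψ-h-· : ∀ N r (f : QSym N) k → Ψ (r ℕ.+ N) (h r · f) k ≈ gaussian q r (suc k) * Ψ N f k
Ψ-h-· N r f k = begin
  eval (fromℚ ∘ coeff (h r · f)) (r ℕ.+ N) xs
    ≈⟨ eval-cong {fromℚ ∘ coeff (h r · f)} {convolution (fromℚ ∘ h-coeff r) (fromℚ ∘ coeff f)} (r ℕ.+ N) xs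
         (λ a _ → fromℚ-sumOver
           (λ (b , c) → h-coeff r b ℚ.* coeff f c) (λ (b , c) → fromℚ (h-coeff r b) * fromℚ (coeff f c))
           (splits a) (λ (b , c) → fromℚ-* (h-coeff r b) (coeff f c))) ⟩
  eval (convolution (fromℚ ∘ h-coeff r) (fromℚ ∘ coeff f)) (r ℕ.+ N) xs
    ≈⟨ eval-complete-* r N (fromℚ ∘ h-coeff r) (fromℚ ∘ coeff f) xs inDegree offDegree ⟩
  gaussian q r (suc k) * Ψ N f k ∎
  where
  open import Relation.Binary.Reasoning.Setoid ≈-setoid
  xs = map (q ^_) (downFrom (suc k))
  inDegree : ∀ a → sum a ≡ r → fromℚ (h-coeff r a) ≈ 1#
  inDegree a a≡r = ℚ⟨q⟩-Ring.reflexive (≡.cong fromℚ (≡.trans (h-coeff-degree r a)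
    (≡.cong (if_then 1ℚ else 0ℚ) (dec-true (sum a ℕ.≟ r) a≡r))))
  offDegree : ∀ a → sum a ≢ r → fromℚ (h-coeff r a) ≈ 0#
  offDegree a a≢r = ℚ⟨q⟩-Ring.reflexive (≡.cong fromℚ (homogeneous (h r) a a≢r))

Q-scales : ∀ r F k → Q r F k ≈ gaussian q r (suc k) * F k
Q-scales zero    F k = begin
  F k                            ≈⟨ *-identityˡ (F k) ⟨
  1# * F k                       ≈⟨ *-cong {1#} {gaussian q 0 (suc k)} {F k} {F k}
                                      (ℚ⟨q⟩-Ring.sym {gaussian q 0 (suc k)} {1#} (gaussian-zero q (suc k)))
                                      (λ _ → ≡.refl) ⟩
  gaussian q 0 (suc k) * F k     ∎
  where open import Relation.Binary.Reasoning.Setoid ≈-setoid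
Q-scales (suc r) F k = begin
  Q r (factor r F) k                    ≈⟨ Q-scales r (factor r F) k ⟩
  gaussian q r (suc k) * factor r F k
    ≈⟨ rescale (q ^ suc r) (q ^ k) (inverse (1# - q ^ suc r) (1-q^suc≢0 r)) (F k)
         (gaussian q (suc r) (suc k)) (gaussian q r (suc k))
         (inverseˡ (1# - q ^ suc r) (1-q^suc≢0 r)) (gaussian-ratio q r k) ⟩
  gaussian q (suc r) (suc k) * F k      ∎
  where open import Relation.Binary.Reasoning.Setoid ≈-setoid

Q-comm : ∀ r s F → Q r (Q s F) ≋ Q s (Q r F)
Q-comm r s F k = begin
  Q r (Q s F) k          ≈⟨ Q-scales r (Q s F) k ⟩
  g * Q s F k            ≈⟨ ℚ⟨q⟩-Ring.*-congˡ {g} {Q s F k} {g′ * F k} (Q-scales s F k) ⟩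
  g * (g′ * F k)         ≈⟨ x∙yz≈y∙xz g g′ (F k) ⟩
  g′ * (g * F k)         ≈⟨ ℚ⟨q⟩-Ring.*-congˡ {g′} {Q r F k} {g * F k} (Q-scales r F k) ⟨
  g′ * Q r F k           ≈⟨ Q-scales s (Q r F) k ⟨
  Q s (Q r F) k          ∎
  where
  open import Relation.Binary.Reasoning.Setoid ≈-setoid
  open import Algebra.Properties.CommutativeSemigroup ℚ⟨q⟩-Ring.*-commutativeSemigroup using (x∙yz≈y∙xz)
  g  = gaussian q r (suc k)
  g′ = gaussian q s (suc k)

theorem22 : (∀ (N r : ℕ) (f : QSym N) → Ψ (r ℕ.+ N) (h r · f) ≋ Q r (Ψ N f))
    × (∀ (r s : ℕ) (F : PowerSeries) → Q r (Q s F) ≋ Q s (Q r F))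
theorem22 =
  (λ N r f k → ℚ⟨q⟩-Ring.trans
    {Ψ (r ℕ.+ N) (h r · f) k} {gaussian q r (suc k) * Ψ N f k} {Q r (Ψ N f) k}
    (Ψ-h-· N r f k)
    (ℚ⟨q⟩-Ring.sym {Q r (Ψ N f) k} {gaussian q r (suc k) * Ψ N f k} (Q-scales r (Ψ N f) k)))
  , Q-comm
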